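{- Let $\Delta$ be a twin building of type $(W,S)$ and let $J\subseteq S$ be nonempty. An automorphism $\theta$ of $\Delta$ maps all $S\setminus J$-residues to opposite residues if and only if it maps all chambers to opposite chambers. Moreover, if $\theta$ maps all chambers to opposite chambers, then $\theta$ is type preserving and maps all residues to opposite residues.
   Context: $(W,S)$ is a Coxeter system with $S$ finite and $W$ irreducible; $W_J$ is the subgroup generated by $J$. A twin building of type $(W,S)$ consists of two buildings $\Delta^+,\Delta^-$ of type $(W,S)$ (with $W$-distance $\delta$) and a codistance $\delta^*$ on pairs of chambers in different halves satisfying the usual axioms (Tw1) $\delta^*(D,C)=\delta^*(C,D)^{ -1}$; (Tw2) if $\delta(D,E)=s\in S$ and $\ell(sw)=\ell(w)-1$ with $w=\delta^*(C,D)$ then $\delta^*(C,E)=sw$; (Tw3) for each $s\in S$ there is $E$ with $\delta(D,E)=s$ and $\delta^*(C,E)=sw$. A $J$-residue of $\Delta^\epsilon$ is a set $\{D\in\Delta^\epsilon:\delta(C,D)\in W_J\}$. Chambers in different halves are opposite if $\delta^*(C,D)=1$; residues $P,Q$ in different halves are opposite if every chamber of $P$ is opposite some chamber of $Q$. An automorphism is a bijection of the chamber set preserving adjacency and opposition; it induces an automorphism $\sigma$ of the Coxeter graph with $s$-adjacent chambers mapped to $\sigma(s)$-adjacent chambers, and it is type preserving if $\sigma$ is the identity. -}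

module Defs where

open import Level using (Level; _⊔_) renaming (suc to lsuc; zero to lzero)
open import Data.Nat using (ℕ; zero; suc; _≤_)
open import Data.Fin using (Fin)
open import Data.Fin.Subset using (Subset; _∈_)
open import Data.Bool using (Bool; true; false; not)
open import Data.List using (List; []; _∷_; _++_; [_]; length; reverse)
open import Data.List.Relation.Unary.All using (All)
open import Data.Product using (Σ; ∃; ∃-syntax; _×_; _,_)
open import Data.Sum using (_⊎_)
open import Data.Empty using (⊥)
open import Relation.Binary.PropositionalEquality using (_≡_; _≢_)
open import Relation.Binary.Construct.Closure.ReflexiveTransitive using (Star)
open import Function.Definitions using (Bijective)
open import Function.Bundles using (_⇔_)

-- Coxeter systems (W,S) with S = Fin n, given by a Coxeter matrix.
-- The entry 0 encodes m(s,t) = ∞.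

record CoxeterMatrix (n : ℕ) : Set where
  field
    m      : Fin n → Fin n → ℕ
    diag   : ∀ s → m s s ≡ 1
    symm   : ∀ s t → m s t ≡ m t s
    offdia : ∀ s t → s ≢ t → m s t ≡ 0 ⊎ 2 ≤ m s t

module Coxeter {n : ℕ} (M : CoxeterMatrix n) where
  open CoxeterMatrix M

  -- elements of W are represented by words in S, modulo the
  -- congruence generated by the Coxeter relations
  Word : Set
  Word = List (Fin n)

  alt : Fin n → Fin n → ℕ → Word
  alt s t zero    = []
  alt s t (suc k) = s ∷ alt t s k

  data Rel : Word → Word → Set where
    invol : ∀ s → Rel (s ∷ s ∷ []) []
    braid : ∀ s t → 1 ≤ m s t → Rel (alt s t (m s t)) (alt t s (m s t))

  infix 4 _≈_
  data _≈_ : Word → Word → Set where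
    ≈-refl  : ∀ {u} → u ≈ u
    ≈-sym   : ∀ {u v} → u ≈ v → v ≈ u
    ≈-trans : ∀ {u v w} → u ≈ v → v ≈ w → u ≈ w
    ≈-step  : ∀ u {l r} v → Rel l r → (u ++ l ++ v) ≈ (u ++ r ++ v)

  HasLength : Word → ℕ → Set
  HasLength w k = (∃[ u ] (u ≈ w × length u ≡ k))
                × (∀ u → u ≈ w → k ≤ length u)

  LenUpˡ : Fin n → Word → Set
  LenUpˡ s w = ∃[ k ] (HasLength w k × HasLength (s ∷ w) (suc k))

  LenDownʳ : Word → Fin n → Set
  LenDownʳ w s = ∃[ k ] (HasLength (w ++ [ s ]) k × HasLength w (suc k))

  InW : Subset n → Word → Set
  InW J w = ∃[ u ] (u ≈ w × All (_∈ J) u)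

  Edge : Fin n → Fin n → Set
  Edge s t = s ≢ t × (m s t ≡ 0 ⊎ 3 ≤ m s t)

Irreducible : ∀ {n} → CoxeterMatrix n → Set
Irreducible {n} M = ∀ (s t : Fin n) → Star (Coxeter.Edge M) s t

record IsBuilding {ℓ} {n} (M : CoxeterMatrix n) (C : Set ℓ)
                  (δ : C → C → Coxeter.Word M) : Set ℓ where
  open Coxeter M
  field
    WD1  : ∀ x y → δ x y ≈ [] → x ≡ y
    WD1' : ∀ x → δ x x ≈ []
    WD2  : ∀ x y x' s → δ x' x ≈ [ s ] →
             (δ x' y ≈ s ∷ δ x y ⊎ δ x' y ≈ δ x y)
             × (LenUpˡ s (δ x y) → δ x' y ≈ s ∷ δ x y)
    WD3  : ∀ x y s → ∃[ x' ] (δ x' x ≈ [ s ] × δ x' y ≈ s ∷ δ x y)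

-- halves: true = Δ⁺, false = Δ⁻
record TwinBuilding {n} (M : CoxeterMatrix n) (ℓ : Level) : Set (lsuc ℓ) where
  open Coxeter M
  field
    Ch   : Bool → Set ℓ
    δ    : ∀ ε → Ch ε → Ch ε → Word
    δ*   : ∀ ε → Ch ε → Ch (not ε) → Word
    bldg : ∀ ε → IsBuilding M (Ch ε) (δ ε)
    Tw1⁺ : ∀ (x : Ch true) (y : Ch false) → δ* false y x ≈ reverse (δ* true x y)
    Tw1⁻ : ∀ (x : Ch false) (y : Ch true) → δ* true y x ≈ reverse (δ* false x y)
    Tw2  : ∀ ε (x : Ch ε) (y y' : Ch (not ε)) s →
             δ (not ε) y y' ≈ [ s ] → LenDownʳ (δ* ε x y) s →
             δ* ε x y' ≈ δ* ε x y ++ [ s ]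
    Tw3  : ∀ ε (x : Ch ε) (y : Ch (not ε)) s →
             ∃[ y' ] (δ (not ε) y y' ≈ [ s ] × δ* ε x y' ≈ δ* ε x y ++ [ s ])

module TwinNotions {ℓ} {n} {M : CoxeterMatrix n} (Δ : TwinBuilding M ℓ) where
  open Coxeter M
  open TwinBuilding Δ

  Chamber : Set ℓ
  Chamber = Σ Bool Ch

  AdjS : Fin n → Chamber → Chamber → Set
  AdjS s (true  , x) (true  , y) = δ true x y ≈ [ s ]
  AdjS s (false , x) (false , y) = δ false x y ≈ [ s ]
  AdjS s _ _ = ⊥

  Adj : Chamber → Chamber → Set
  Adj x y = ∃[ s ] AdjS s x y

  Opp : Chamber → Chamber → Set
  Opp (true  , x) (false , y) = δ* true x y ≈ []
  Opp (false , x) (true  , y) = δ* false x y ≈ []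
  Opp _ _ = ⊥

  InRes : Subset n → Chamber → Chamber → Set
  InRes J (true  , x) (true  , y) = InW J (δ true x y)
  InRes J (false , x) (false , y) = InW J (δ false x y)
  InRes J _ _ = ⊥

  record Automorphism : Set ℓ where
    field
      θ   : Chamber → Chamber
      bij : Bijective _≡_ _≡_ θ
      adj : ∀ x y → Adj x y ⇔ Adj (θ x) (θ y)
      opp : ∀ x y → Opp x y ⇔ Opp (θ x) (θ y)

  module _ (A : Automorphism) where
    open Automorphism A

    MapsChambersOpp : Set ℓ
    MapsChambersOpp = ∀ x → Opp x (θ x)

    -- for the J-residue R of x: R and θ(R) are opposite, i.e. every
    -- chamber of R is opposite some chamber of θ(R)
    MapsResiduesOpp : Subset n → Set ℓ
    MapsResiduesOpp J = ∀ x y → InRes J x y →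
                          ∃[ z ] (InRes J x z × Opp y (θ z))

    TypePreserving : Set ℓ
    TypePreserving = ∀ s x y → AdjS s x y → AdjS s (θ x) (θ y)

{-# OPTIONS --safe #-}

-- An adjacency-preserving bijection need not permute the types, so the argument runs on codistances only.
-- Fix s ∈ J. If θ maps the S∖J-residues to opposite ones, then θ preserves the s-panels of suitable
-- chambers, and connectedness of residues gives δ*(x , θ x) ∈ ⟨S∖s⟩ for all x. Moving x to an s-adjacent
-- x′ with δ*(x′ , θ x) = s w shows that s w s ∈ ⟨S∖s⟩ as well; this forces w into the subgroup generated
-- by the generators commuting with s. Hence δ*(x , θ x) avoids every neighbour of s in the Coxeter graph,
-- and by irreducibility it avoids all generators.
--
-- The facts needed about W, including the existence of lengths, come from an integral
-- representation: W is folded from a simply laced Coxeter group by replacing each bond m with diagrams of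
-- type A_{m-1}. On such a diagram the dihedral group ⟨s , t⟩ acts by a discrete wave equation with
-- reflecting ends, whose solutions have period m up to reversal and stay positive until then.
module Submission where

open import Defs
open import Level using (Level)
open import Data.Nat as ℕ using (ℕ; zero; suc; z≤n; s≤s)
import Data.Nat.Divisibility as ℕ
import Data.Nat.Properties as ℕ
import Data.Nat.Tactic.RingSolver as ℕ
open import Data.Integer as ℤ using (ℤ; +_; -_; _+_; _-_; _*_; 0ℤ; 1ℤ; +0)
open import Data.Integer.Divisibility.Signed using (_∣_; _∣?_; ∣-refl; ∣m∣n⇒∣m-n; ∣⇒∣ᵤ; divides)
import Data.Integer.Properties as ℤ
open import Data.Integer.Tactic.RingSolver using (solve-∀)
open import Algebra.Properties.AbelianGroup ℤ.+-0-abelianGroup using (∙-cancelʳ)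
open import Data.Bool using (Bool; true; false; not; if_then_else_)
import Data.Bool.Properties as Bool
open import Data.Empty using (⊥; ⊥-elim)
open import Data.Fin as Fin using (Fin; zero; suc; combine; remQuot)
import Data.Fin.Properties as Fin
open import Data.Fin.Subset using (Subset; ∁; Nonempty; _∈_)
open import Data.Fin.Subset.Properties using (x∈∁p⇒x∉p)
open import Data.List using ([]; _∷_; _++_; [_]; length; reverse)
import Data.List.Properties as List
open import Data.List.Relation.Unary.All as All using (All; []; _∷_)
import Data.List.Relation.Unary.All.Properties as All
open import Data.Product using (∃-syntax; _×_; _,_; proj₁; proj₂; uncurry)
open import Data.Sum as Sum using (_⊎_; inj₁; inj₂; [_,_]′)
open import Data.Unit using (⊤; tt)
open import Data.Vec using (Vec; []; _∷_; lookup; _[_]≔_; replicate)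
open import Data.Vec.Properties
  using ([]≔-lookup; []≔-idempotent; []≔-commutes; lookup∘update; lookup∘update′; lookup-replicate)
open import Function using (_∘_; id)
open import Function.Bundles using (_⇔_; mk⇔; Equivalence)
open import Relation.Binary.Construct.Closure.ReflexiveTransitive as Star using (Star; ε; _◅_; _◅◅_)
open import Relation.Binary.PropositionalEquality
  using (_≡_; _≢_; refl; sym; trans; cong; cong₂; subst; subst₂; module ≡-Reasoning)
open import Relation.Nullary using (¬_; Dec; yes; no; contradiction; does)
open import Relation.Nullary.Decidable using (does-⇔; dec-true; dec-false)

-- The discrete wave equation with reflecting ends

i≡-i⇒i≡0 : ∀ {i} → i ≡ - i → i ≡ 0ℤ
i≡-i⇒i≡0 {+ zero}     _  = refl
i≡-i⇒i≡0 {+ suc _}    ()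
i≡-i⇒i≡0 {ℤ.-[1+ _ ]} ()

-- Oddness about the point a/2. The values a = 0 and a = 2m encode reflecting ends at 0 and m, where
-- odd functions vanish.
Antisym : ℤ → (ℤ → ℤ) → Set
Antisym a b = ∀ i → b (a - i) ≡ - b i

-- As in the Coxeter matrix, m = 0 stands for infinity: the string is then a half-line.
Interior : ℕ → ℤ → Set
Interior m i = ∃[ j ] (i ≡ + suc j × (m ≡ 0 ⊎ suc j ℕ.< m))

-- The solution of u(k+2,i) + u(k,i) = u(k+1,i+1) + u(k+1,i-1) with data `- p` and `q` at times 0
-- and 1. The sign of `p` makes time reversal exchange `q` and `p`.
wave : (q p : ℤ → ℤ) → ℕ → ℤ → ℤ
wave q p zero          i = - p i
wave q p (suc zero)    i = q i
wave q p (suc (suc k)) i =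
  (- wave q p k i + wave q p (suc k) (i + 1ℤ)) + wave q p (suc k) (i - 1ℤ)

wave-antisym : ∀ a {q p} → Antisym a q → Antisym a p → ∀ k → Antisym a (wave q p k)
wave-antisym a         Aq Ap zero          i = cong -_ (Ap i)
wave-antisym a         Aq Ap (suc zero)    i = Aq i
wave-antisym a {q} {p} Aq Ap (suc (suc k)) i = begin
  (- W k (a - i) + W (suc k) ((a - i) + 1ℤ)) + W (suc k) ((a - i) - 1ℤ)
    ≡⟨ cong₂ (λ x y → (- W k (a - i) + W (suc k) x) + W (suc k) y)
             (e₁ a i) (e₂ a i) ⟩
  (- W k (a - i) + W (suc k) (a - (i - 1ℤ))) + W (suc k) (a - (i + 1ℤ))
    ≡⟨ cong₂ _+_ (cong₂ (λ x y → - x + y) (wave-antisym a Aq Ap k i) (wave-antisym a Aq Ap (suc k) (i - 1ℤ)))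
                 (wave-antisym a Aq Ap (suc k) (i + 1ℤ)) ⟩
  (- - W k i + - W (suc k) (i - 1ℤ)) + - W (suc k) (i + 1ℤ)
    ≡⟨ e₃ (W k i) (W (suc k) (i - 1ℤ)) (W (suc k) (i + 1ℤ)) ⟩
  - ((- W k i + W (suc k) (i + 1ℤ)) + W (suc k) (i - 1ℤ)) ∎
  where
  open ≡-Reasoning
  W = wave q p
  e₁ : ∀ a i → (a - i) + 1ℤ ≡ a - (i - 1ℤ)
  e₁ = solve-∀
  e₂ : ∀ a i → (a - i) - 1ℤ ≡ a - (i + 1ℤ)
  e₂ = solve-∀
  e₃ : ∀ x y z → (- - x + - y) + - z ≡ - ((- x + z) + y)
  e₃ = solve-∀

-- The right-moving part of a solution is constant along the characteristics i + k.
wave-characteristic : ∀ q p k i →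
  wave q p (suc k) (i + 1ℤ) ≡ wave q p k i + (q ((i + 1ℤ) + + k) + p (i + + k))
wave-characteristic q p zero i = begin
  q (i + 1ℤ)                                         ≡⟨ e (q (i + 1ℤ)) (p i) ⟩
  - p i + (q (i + 1ℤ) + p i)
    ≡⟨ cong₂ (λ x y → - p i + (q x + p y)) (sym (ℤ.+-identityʳ (i + 1ℤ))) (sym (ℤ.+-identityʳ i)) ⟩
  - p i + (q ((i + 1ℤ) + 0ℤ) + p (i + 0ℤ)) ∎
  where
  open ≡-Reasoning
  e : ∀ x y → x ≡ - y + (x + y)
  e = solve-∀
wave-characteristic q p (suc k) i = begin
  (- W k (i + 1ℤ) + W (suc k) ((i + 1ℤ) + 1ℤ)) + W (suc k) ((i + 1ℤ) - 1ℤ)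
    ≡⟨ cong₂ (λ x y → (- W k (i + 1ℤ) + x) + W (suc k) y) (wave-characteristic q p k (i + 1ℤ)) (e₁ i) ⟩
  (- W k (i + 1ℤ) + (W k (i + 1ℤ) + (q (((i + 1ℤ) + 1ℤ) + + k) + p ((i + 1ℤ) + + k)))) + W (suc k) i
    ≡⟨ e₂ (W k (i + 1ℤ)) _ (W (suc k) i) ⟩
  W (suc k) i + (q (((i + 1ℤ) + 1ℤ) + + k) + p ((i + 1ℤ) + + k))
    ≡⟨ cong₂ (λ x y → W (suc k) i + (q x + p y)) (e₃ (i + 1ℤ) (+ k)) (e₃ i (+ k)) ⟩
  W (suc k) i + (q ((i + 1ℤ) + + suc k) + p (i + + suc k)) ∎
  where
  open ≡-Reasoning
  W = wave q p
  e₁ : ∀ i → (i + 1ℤ) - 1ℤ ≡ i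
  e₁ = solve-∀
  e₂ : ∀ x y z → (- x + (x + y)) + z ≡ z + y
  e₂ = solve-∀
  e₃ : ∀ i k → (i + 1ℤ) + k ≡ i + (1ℤ + k)
  e₃ = solve-∀

module Bounded (m : ℕ) {q p : ℤ → ℤ}
  (q₀ : Antisym 0ℤ q) (q₂ₘ : Antisym (+ m + + m) q)
  (p₀ : Antisym 0ℤ p) (p₂ₘ : Antisym (+ m + + m) p) where

  private
    M : ℤ
    M = + m

    periodic : ∀ {b} → Antisym 0ℤ b → Antisym (M + M) b → ∀ i → b ((M + M) + i) ≡ b i
    periodic {b} b₀ b₂ i = begin
      b ((M + M) + i)          ≡⟨ cong b (e₁ (M + M) i) ⟩
      b ((M + M) - (0ℤ - i))   ≡⟨ b₂ (0ℤ - i) ⟩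
      - b (0ℤ - i)             ≡⟨ cong -_ (b₀ i) ⟩
      - - b i                  ≡⟨ ℤ.neg-involutive (b i) ⟩
      b i ∎
      where
      open ≡-Reasoning
      e₁ : ∀ a i → a + i ≡ a - (0ℤ - i)
      e₁ = solve-∀

  wave-0 : ∀ k → wave q p k 0ℤ ≡ 0ℤ
  wave-0 k = i≡-i⇒i≡0 (wave-antisym 0ℤ q₀ p₀ k 0ℤ)

  wave-m : ∀ k → wave q p k M ≡ 0ℤ
  wave-m k = i≡-i⇒i≡0 (trans (cong (wave q p k) (sym (e M))) (wave-antisym (M + M) q₂ₘ p₂ₘ k M))
    where
    e : ∀ x → (x + x) - x ≡ x
    e = solve-∀

  private
    -- Induction on the distance from the reflecting end, where both sides vanish. One step along a
    -- characteristic adds the same amount `H` to both, because `q` and `p` have period 2m.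
    glide⁻ : ∀ j k → wave q p (m ℕ.+ k) (M - + j) ≡ wave q p k (- + j)
    glide⁻ zero k = begin
      wave q p (m ℕ.+ k) (M - + 0)   ≡⟨ cong (wave q p (m ℕ.+ k)) (ℤ.+-identityʳ M) ⟩
      wave q p (m ℕ.+ k) M           ≡⟨ wave-m (m ℕ.+ k) ⟩
      0ℤ                             ≡⟨ wave-0 k ⟨
      wave q p k 0ℤ ∎
      where open ≡-Reasoning
    glide⁻ (suc j) k = ∙-cancelʳ H _ _ (begin
      W (m ℕ.+ k) (M - + suc j) + H
        ≡⟨ cong₂ (λ x y → W (m ℕ.+ k) (M - + suc j) + (x + y))
             (trans (sym (periodic q₀ q₂ₘ _)) (cong q (f₁ M (+ j) (+ k))))
             (trans (sym (periodic p₀ p₂ₘ _)) (cong p (f₂ M (+ j) (+ k)))) ⟩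
      W (m ℕ.+ k) (M - + suc j) + (q (((M - + suc j) + 1ℤ) + + (m ℕ.+ k)) + p ((M - + suc j) + + (m ℕ.+ k)))
        ≡⟨ wave-characteristic q p (m ℕ.+ k) (M - + suc j) ⟨
      W (suc (m ℕ.+ k)) ((M - + suc j) + 1ℤ)
        ≡⟨ cong₂ W (sym (ℕ.+-suc m k)) (f₃ M (+ j)) ⟩
      W (m ℕ.+ suc k) (M - + j)      ≡⟨ glide⁻ j (suc k) ⟩
      W (suc k) (- + j)              ≡⟨ cong (W (suc k)) (f₄ (+ j)) ⟩
      W (suc k) ((- + suc j) + 1ℤ)   ≡⟨ wave-characteristic q p k (- + suc j) ⟩
      W k (- + suc j) + H ∎)
      where
      open ≡-Reasoning
      W = wave q p
      H = q (((- + suc j) + 1ℤ) + + k) + p ((- + suc j) + + k)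
      f₁ : ∀ M j k → (M + M) + (((- (1ℤ + j)) + 1ℤ) + k) ≡ ((M - (1ℤ + j)) + 1ℤ) + (M + k)
      f₁ = solve-∀
      f₂ : ∀ M j k → (M + M) + ((- (1ℤ + j)) + k) ≡ (M - (1ℤ + j)) + (M + k)
      f₂ = solve-∀
      f₃ : ∀ M j → (M - (1ℤ + j)) + 1ℤ ≡ M - j
      f₃ = solve-∀
      f₄ : ∀ j → - j ≡ (- (1ℤ + j)) + 1ℤ
      f₄ = solve-∀

  wave-glide : ∀ k i → wave q p (m ℕ.+ k) (M + i) ≡ wave q p k i
  wave-glide k (+ j) = begin
    W (m ℕ.+ k) (M + + j)               ≡⟨ cong (W (m ℕ.+ k)) (e M (+ j)) ⟩
    W (m ℕ.+ k) ((M + M) - (M - + j))   ≡⟨ wave-antisym (M + M) q₂ₘ p₂ₘ (m ℕ.+ k) (M - + j) ⟩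
    - W (m ℕ.+ k) (M - + j)             ≡⟨ cong -_ (glide⁻ j k) ⟩
    - W k (- + j)                       ≡⟨ cong (λ x → - W k x) (ℤ.+-identityˡ (- + j)) ⟨
    - W k (0ℤ - + j)                    ≡⟨ cong -_ (wave-antisym 0ℤ q₀ p₀ k (+ j)) ⟩
    - - W k (+ j)                       ≡⟨ ℤ.neg-involutive _ ⟩
    W k (+ j) ∎
    where
    open ≡-Reasoning
    W = wave q p
    e : ∀ M i → M + i ≡ (M + M) - (M - i)
    e = solve-∀
  wave-glide k ℤ.-[1+ j ] = glide⁻ (suc j) k

  -- The recurrence is symmetric under reversal of time and space, and the glide identifies the
  -- slices at times m+1 and m with the data `- q` and `p` of the reversed solution.
  wave-reversal : ∀ k k′ → k ℕ.+ k′ ≡ suc m → ∀ i → wave q p k′ (M - i) ≡ wave p q k i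
  wave-reversal zero k′ refl i = begin
    W (suc m) (M - i)       ≡⟨ cong (λ x → W x (M - i)) (ℕ.+-comm 1 m) ⟩
    W (m ℕ.+ 1) (M - i)     ≡⟨ wave-glide 1 (- i) ⟩
    q (- i)                 ≡⟨ cong q (ℤ.+-identityˡ (- i)) ⟨
    q (0ℤ - i)              ≡⟨ q₀ i ⟩
    - q i ∎
    where
    open ≡-Reasoning
    W = wave q p
  wave-reversal (suc zero) k′ refl i = begin
    W m (M - i)             ≡⟨ cong (λ x → W x (M - i)) (ℕ.+-identityʳ m) ⟨
    W (m ℕ.+ 0) (M - i)     ≡⟨ wave-glide 0 (- i) ⟩
    - p (- i)               ≡⟨ cong (λ x → - p x) (ℤ.+-identityˡ (- i)) ⟨
    - p (0ℤ - i)            ≡⟨ cong -_ (p₀ i) ⟩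
    - - p i                 ≡⟨ ℤ.neg-involutive (p i) ⟩
    p i ∎
    where
    open ≡-Reasoning
    W = wave q p
  wave-reversal (suc (suc k)) k′ eq i = begin
    W k′ (M - i)
      ≡⟨ e₁ (W k′ (M - i)) (W (suc k′) ((M - i) + 1ℤ)) (W (suc k′) ((M - i) - 1ℤ)) ⟩
    (- W (suc (suc k′)) (M - i) + W (suc k′) ((M - i) - 1ℤ)) + W (suc k′) ((M - i) + 1ℤ)
      ≡⟨ cong₂ (λ x y → (- W (suc (suc k′)) (M - i) + W (suc k′) x) + W (suc k′) y) (e₂ M i) (e₃ M i) ⟩
    (- W (suc (suc k′)) (M - i) + W (suc k′) (M - (i + 1ℤ))) + W (suc k′) (M - (i - 1ℤ))
      ≡⟨ cong₂ _+_ (cong₂ (λ x y → - x + y) (wave-reversal k (suc (suc k′)) eq₂ i)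
                                            (wave-reversal (suc k) (suc k′) eq₁ (i + 1ℤ)))
                   (wave-reversal (suc k) (suc k′) eq₁ (i - 1ℤ)) ⟩
    wave p q (suc (suc k)) i ∎
    where
    open ≡-Reasoning
    W = wave q p
    eq₁ : suc k ℕ.+ suc k′ ≡ suc m
    eq₁ = trans (ℕ.+-suc (suc k) k′) eq
    eq₂ : k ℕ.+ suc (suc k′) ≡ suc m
    eq₂ = trans (ℕ.+-suc k (suc k′)) eq₁
    e₁ : ∀ x y z → x ≡ (- ((- x + y) + z) + z) + y
    e₁ = solve-∀
    e₂ : ∀ M i → (M - i) - 1ℤ ≡ M - (i + 1ℤ)
    e₂ = solve-∀
    e₃ : ∀ M i → (M - i) + 1ℤ ≡ M - (i - 1ℤ)
    e₃ = solve-∀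

-- Stated for an arbitrary additively closed G, to cover both weak and strict positivity.
module Positive {G : ℤ → Set} (G-+ : ∀ {x y} → G x → G y → G (x + y)) (m : ℕ) where

  private
    lower : ∀ {a b} → a ℕ.≤ b → m ≡ 0 ⊎ b ℕ.< m → m ≡ 0 ⊎ a ℕ.< m
    lower a≤b (inj₁ m≡0) = inj₁ m≡0
    lower a≤b (inj₂ b<m) = inj₂ (ℕ.≤-<-trans a≤b b<m)

    -- Here the characteristics have not yet met the far end, so each step back along one adds
    -- values of `q` and `p` at interior points only.
    below-diagonal : ∀ {q p} → Antisym 0ℤ q → Antisym 0ℤ p →
      (∀ {i} → Interior m i → G (q i)) → (∀ {i} → Interior m i → G (p i)) →
      ∀ k j → m ≡ 0 ⊎ j ℕ.+ suc k ℕ.< m → G (wave q p (suc k) (+ suc j))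
    below-diagonal q₀ p₀ Gq Gp zero j lt = Gq (j , refl , lower (ℕ.≤-reflexive (ℕ.+-comm 1 j)) lt)
    below-diagonal {q} {p} q₀ p₀ Gq Gp (suc k) j lt =
      subst G (trans (sym (wave-characteristic q p (suc k) (+ j)))
                     (cong (wave q p (suc (suc k))) (cong +_ (ℕ.+-comm j 1))))
            (rest j lt)
      where
      h : ℕ → ℤ
      h j = q ((+ j + 1ℤ) + + suc k) + p (+ j + + suc k)
      Gh : ∀ j → m ≡ 0 ⊎ j ℕ.+ suc (suc k) ℕ.< m → G (h j)
      Gh j lt = G-+
        (Gq (j ℕ.+ suc k , cong (λ x → + (x ℕ.+ suc k)) (ℕ.+-comm j 1) ,
             lower (ℕ.≤-reflexive (sym (ℕ.+-suc j (suc k)))) lt))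
        (Gp (j ℕ.+ k , cong +_ (ℕ.+-suc j k) ,
             lower (ℕ.≤-trans (ℕ.≤-reflexive (sym (ℕ.+-suc j k))) (ℕ.+-monoʳ-≤ j (ℕ.n≤1+n (suc k)))) lt))
      rest : ∀ j → m ≡ 0 ⊎ j ℕ.+ suc (suc k) ℕ.< m → G (wave q p (suc k) (+ j) + h j)
      -- The wave vanishes at the reflecting end, so positivity has to come from `h 0` alone.
      rest zero    lt = subst G
        (sym (trans (cong (_+ h 0) (i≡-i⇒i≡0 (wave-antisym 0ℤ q₀ p₀ (suc k) 0ℤ))) (ℤ.+-identityˡ (h 0))))
        (Gh 0 lt)
      rest (suc j) lt = G-+
        (below-diagonal q₀ p₀ Gq Gp k j
          (lower (ℕ.≤-trans (ℕ.+-monoʳ-≤ j (ℕ.n≤1+n (suc k))) (ℕ.n≤1+n _)) lt))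
        (Gh (suc j) lt)

  -- Points on or beyond the diagonal are carried below it by time reversal, with `q` and `p`
  -- exchanged.
  wave-positive : ∀ {q p} →
    Antisym 0ℤ q → Antisym (+ m + + m) q → Antisym 0ℤ p → Antisym (+ m + + m) p →
    (∀ {i} → Interior m i → G (q i)) → (∀ {i} → Interior m i → G (p i)) →
    ∀ k → m ≡ 0 ⊎ k ℕ.< m → ∀ {i} → Interior m i → G (wave q p (suc k) i)
  wave-positive q₀ q₂ p₀ p₂ Gq Gp k (inj₁ m≡0) (j , refl , _) = below-diagonal q₀ p₀ Gq Gp k j (inj₁ m≡0)
  wave-positive q₀ q₂ p₀ p₂ Gq Gp k (inj₂ k<m) (j , refl , inj₁ m≡0) = below-diagonal q₀ p₀ Gq Gp k j (inj₁ m≡0)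
  wave-positive {q} {p} q₀ q₂ p₀ p₂ Gq Gp k (inj₂ k<m) (j , refl , inj₂ j<m) with j ℕ.+ suc k ℕ.<? m
  ... | yes lt = below-diagonal q₀ p₀ Gq Gp k j (inj₂ lt)
  ... | no ≮   = go _ _ (proj₂ (ℕ.m≤n⇒∃[o]m+o≡n k<m)) (proj₂ (ℕ.m≤n⇒∃[o]m+o≡n j<m))
    where
    -- k + 1 + k′ = m = j + 2 + j′, so the reflected point is (k′ + 1, j′ + 1)
    go : ∀ k′ j′ → suc k ℕ.+ k′ ≡ m → suc (suc j) ℕ.+ j′ ≡ m → G (wave q p (suc k) (+ suc j))
    go k′ j′ ek ej′ = subst G
        (trans (sym (Bounded.wave-reversal m q₀ q₂ p₀ p₂ (suc k′) (suc k) eq (+ suc j′)))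
               (cong (wave q p (suc k)) eq′))
        (below-diagonal p₀ q₀ Gp Gq k′ j′ (inj₂ lt))
      where
      eq : suc k′ ℕ.+ suc k ≡ suc m
      eq = cong suc (trans (ℕ.+-comm k′ (suc k)) ek)
      ej : suc j ℕ.+ suc j′ ≡ m
      ej = trans (ℕ.+-suc (suc j) j′) ej′
      e : ∀ x y → (x + y) - y ≡ x
      e = solve-∀
      eq′ : + m - + suc j′ ≡ + suc j
      eq′ = trans (cong (_- + suc j′) (cong +_ (sym ej))) (e (+ suc j) (+ suc j′))
      lt : j′ ℕ.+ suc k′ ℕ.< m
      lt = ℕ.+-cancelˡ-≤ m _ _ (begin
        m ℕ.+ suc (j′ ℕ.+ suc k′)              ≤⟨ ℕ.+-monoˡ-≤ _ (ℕ.≮⇒≥ ≮) ⟩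
        (j ℕ.+ suc k) ℕ.+ suc (j′ ℕ.+ suc k′)  ≡⟨ e₂ j k j′ k′ ⟩
        (suc k ℕ.+ k′) ℕ.+ (suc j ℕ.+ suc j′)  ≡⟨ cong₂ ℕ._+_ ek ej ⟩
        m ℕ.+ m                                ∎)
        where
        open ℕ.≤-Reasoning
        e₂ : ∀ j k j′ k′ → (j ℕ.+ suc k) ℕ.+ suc (j′ ℕ.+ suc k′) ≡ (suc k ℕ.+ k′) ℕ.+ (suc j ℕ.+ suc j′)
        e₂ = ℕ.solve-∀

-- Positive functions that are odd about both ends

χ : ℤ → ℤ → ℤ
χ d i = if does (d ∣? i) then 1ℤ else 0ℤ

χ-reflect : ∀ {d a} → d ∣ a → ∀ i → χ d (a - i) ≡ χ d i
χ-reflect {d} {a} d∣a i = cong (if_then 1ℤ else 0ℤ) (does-⇔ (mk⇔ to from) (d ∣? (a - i)) (d ∣? i))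
  where
  e : ∀ a i → a - (a - i) ≡ i
  e = solve-∀
  to : d ∣ a - i → d ∣ i
  to d∣a-i = subst (d ∣_) (e a i) (∣m∣n⇒∣m-n d∣a d∣a-i)
  from : d ∣ i → d ∣ a - i
  from = ∣m∣n⇒∣m-n d∣a

χ-nonneg : ∀ d i → 0ℤ ℤ.≤ χ d i
χ-nonneg d i with does (d ∣? i)
... | true  = ℤ.+≤+ z≤n
... | false = ℤ.+≤+ z≤n

-- For d = 2m and k = m-1 this is the d-periodic square wave: 1 at the residues 1, ..., k, -1 at
-- their negatives, and 0 at multiples of m. Writing it as a sum of differences makes oddness a
-- termwise matter.
squareWave : ℤ → ℕ → ℤ → ℤ
squareWave d zero    i = 0ℤ
squareWave d (suc k) i = squareWave d k i + (χ d (i - + suc k) - χ d (i + + suc k))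

squareWave-antisym : ∀ {d a} → d ∣ a → ∀ k → Antisym a (squareWave d k)
squareWave-antisym d∣a zero    i = refl
squareWave-antisym {d} {a} d∣a (suc k) i = begin
  squareWave d k (a - i) + (χ d ((a - i) - + suc k) - χ d ((a - i) + + suc k))
    ≡⟨ cong₂ (λ x y → squareWave d k (a - i) + (χ d x - χ d y)) (e₁ a i (+ suc k)) (e₂ a i (+ suc k)) ⟩
  squareWave d k (a - i) + (χ d (a - (i + + suc k)) - χ d (a - (i - + suc k)))
    ≡⟨ cong₂ _+_ (squareWave-antisym d∣a k i) (cong₂ _-_ (χ-reflect d∣a (i + + suc k)) (χ-reflect d∣a (i - + suc k))) ⟩
  - squareWave d k i + (χ d (i + + suc k) - χ d (i - + suc k))
    ≡⟨ e₃ (squareWave d k i) (χ d (i + + suc k)) (χ d (i - + suc k)) ⟩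
  - squareWave d (suc k) i ∎
  where
  open ≡-Reasoning
  e₁ : ∀ a i k → (a - i) - k ≡ a - (i + k)
  e₁ = solve-∀
  e₂ : ∀ a i k → (a - i) + k ≡ a - (i - k)
  e₂ = solve-∀
  e₃ : ∀ x y z → - x + (y - z) ≡ - (x + (z - y))
  e₃ = solve-∀

module _ (m j : ℕ) (j<m : suc j ℕ.< m) where

  private
    d : ℤ
    d = + (m ℕ.+ m)

    χ-sum : ∀ k → suc k ℕ.< m → χ d (+ suc j + + suc k) ≡ 0ℤ
    χ-sum k k<m = cong (if_then 1ℤ else 0ℤ)
      (dec-false (d ∣? (+ suc j + + suc k))
        (λ d∣ → ℕ.>⇒∤ (ℕ.+-mono-< j<m k<m) (∣⇒∣ᵤ {d} {+ suc j + + suc k} d∣)))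

    χ-diff : ∀ k → suc k ℕ.< m → χ d (+ suc j - + suc k) - χ d (+ suc j + + suc k) ≡ χ d (+ suc j - + suc k)
    χ-diff k k<m = trans (cong (λ x → χ d (+ suc j - + suc k) - x) (χ-sum k k<m)) (ℤ.+-identityʳ _)

  squareWave-nonneg : ∀ k → k ℕ.< m → 0ℤ ℤ.≤ squareWave d k (+ suc j)
  squareWave-nonneg zero    k<m = ℤ.≤-refl
  squareWave-nonneg (suc k) k<m = ℤ.+-mono-≤ (squareWave-nonneg k (ℕ.<⇒≤ k<m))
    (subst (0ℤ ℤ.≤_) (sym (χ-diff k k<m)) (χ-nonneg d (+ suc j - + suc k)))

  -- The summand of index `suc j` equals 1. The others are nonnegative, since a sum of two positive
  -- numbers below m is never a multiple of 2m.
  squareWave-positive : ∀ k → k ℕ.< m → suc j ℕ.≤ k → 0ℤ ℤ.< squareWave d k (+ suc j)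
  squareWave-positive (suc k) k<m j≤k with ℕ.m≤n⇒m<n∨m≡n j≤k
  ... | inj₁ (s≤s j<k) = ℤ.+-mono-<-≤ (squareWave-positive k (ℕ.<⇒≤ k<m) j<k)
    (subst (0ℤ ℤ.≤_) (sym (χ-diff k k<m)) (χ-nonneg d (+ suc j - + suc k)))
  ... | inj₂ refl = ℤ.+-mono-≤-< (squareWave-nonneg k (ℕ.<⇒≤ k<m))
    (subst (0ℤ ℤ.<_) (sym (trans (χ-diff k k<m) one)) (ℤ.+<+ (s≤s z≤n)))
    where
    one : χ d (+ suc j - + suc j) ≡ 1ℤ
    one = cong (if_then 1ℤ else 0ℤ) (dec-true (d ∣? _) (divides 0ℤ (ℤ.+-inverseʳ (+ suc j))))

-- On the half-line m = 0 the two reflection centres coincide at 0, and the identity is odd there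
-- and positive beyond.
bump : ℕ → ℤ → ℤ
bump zero    i = i
bump (suc m) i = squareWave (+ (suc m ℕ.+ suc m)) m i

bump-antisym : ∀ m {a} → a ≡ 0ℤ ⊎ a ≡ + m + + m → Antisym a (bump m)
bump-antisym zero    (inj₁ refl) i = ℤ.+-identityˡ (- i)
bump-antisym zero    (inj₂ refl) i = ℤ.+-identityˡ (- i)
bump-antisym (suc m) (inj₁ refl) = squareWave-antisym (divides 0ℤ refl) m
bump-antisym (suc m) (inj₂ refl) = squareWave-antisym ∣-refl m

bump-positive : ∀ m {i} → Interior m i → 0ℤ ℤ.< bump m i
bump-positive zero    (j , refl , _)       = ℤ.+<+ (s≤s z≤n)
bump-positive (suc m) (j , refl , inj₂ lt) = squareWave-positive (suc m) j lt m ℕ.≤-refl (ℕ.≤-pred lt)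

bumps : ∀ {N} → (Fin N → ℕ) → Vec ℤ N → ℤ
bumps bd []      = 1ℤ
bumps bd (x ∷ f) = bump (bd zero) x * bumps (bd ∘ suc) f

bumps-antisym : ∀ {N} (bd : Fin N → ℕ) c {a} → a ≡ 0ℤ ⊎ a ≡ + bd c + + bd c →
                ∀ f → Antisym a (λ i → bumps bd (f [ c ]≔ i))
bumps-antisym bd zero    {a} h (x ∷ f) i = trans (cong (_* bumps (bd ∘ suc) f) (bump-antisym (bd zero) h i))
  (sym (ℤ.neg-distribˡ-* (bump (bd zero) i) _))
bumps-antisym bd (suc c) {a} h (x ∷ f) i = trans (cong (bump (bd zero) x *_) (bumps-antisym (bd ∘ suc) c h f i))
  (sym (ℤ.neg-distribʳ-* (bump (bd zero) x) _))

bumps-positive : ∀ {N} (bd : Fin N → ℕ) f → (∀ c → Interior (bd c) (lookup f c)) → 0ℤ ℤ.< bumps bd f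
bumps-positive bd []      _  = ℤ.+<+ (s≤s z≤n)
bumps-positive bd (x ∷ f) int with bump (bd zero) x | bump-positive (bd zero) (int zero)
                                 | bumps (bd ∘ suc) f | bumps-positive (bd ∘ suc) f (int ∘ suc)
... | ℤ.+[1+ _ ] | _ | ℤ.+[1+ _ ] | _ = ℤ.+<+ (s≤s z≤n)
... | +0 | ℤ.+<+ () | _ | _
... | ℤ.+[1+ _ ] | _ | +0 | ℤ.+<+ ()

-- The folded integral representation of W

module Representation {n : ℕ} (M : CoxeterMatrix n) where

  open CoxeterMatrix M
  open Coxeter M

  -- A bond is an unordered pair, so its two generators are sorted in order to share one coordinate.
  coord : Fin n → Fin n → Fin (n ℕ.* n)
  coord s t with s Fin.≤? t
  ... | yes _ = combine s t
  ... | no  _ = combine t s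

  coord-comm : ∀ s t → coord s t ≡ coord t s
  coord-comm s t with s Fin.≤? t | t Fin.≤? s
  ... | yes p | yes q = cong₂ combine (Fin.≤-antisym p q) (Fin.≤-antisym q p)
  ... | yes p | no ¬q = refl
  ... | no ¬p | yes q = refl
  ... | no ¬p | no ¬q = contradiction (Fin.≤-total s t) [ ¬p , ¬q ]′

  -- The diagonal entries 1 would leave no interior point; they are never used.
  bound : ℕ → ℕ
  bound 1 = 0
  bound k = k

  bd : Fin (n ℕ.* n) → ℕ
  bd c = bound (uncurry m (remQuot {n} n c))

  bound-m : ∀ {s t} → s ≢ t → bound (m s t) ≡ m s t
  bound-m {s} {t} s≢t with m s t | offdia s t s≢t
  ... | 0           | _ = refl
  ... | 1           | inj₁ ()
  ... | 1           | inj₂ (s≤s ())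
  ... | suc (suc _) | _ = refl

  bd-coord : ∀ {s t} → s ≢ t → bd (coord s t) ≡ m s t
  bd-coord {s} {t} s≢t with s Fin.≤? t
  ... | yes _ = trans (cong (bound ∘ uncurry m) (Fin.remQuot-combine {n} s t)) (bound-m s≢t)
  ... | no  _ = trans (cong (bound ∘ uncurry m) (Fin.remQuot-combine {n} t s))
                      (trans (bound-m (s≢t ∘ sym)) (symm t s))

  -- A state is a weight for a simply laced diagram folding onto that of M: its nodes over s are the
  -- fundamental points, and a bond m s t becomes strings of type A_{m-1} in the coordinate of {s , t}.
  -- States are extended antisymmetrically beyond the ends of the strings, so that the reflections
  -- need no boundary cases.
  Point : Set
  Point = Vec ℤ (n ℕ.* n)

  State : Set
  State = Fin n → Point → ℤ

  infix 4 _≐_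
  _≐_ : State → State → Set
  λ₁ ≐ λ₂ = ∀ r f → λ₁ r f ≡ λ₂ r f

  ≐-sym : ∀ {κ μ} → κ ≐ μ → μ ≐ κ
  ≐-sym e r f = sym (e r f)

  ≐-trans : ∀ {κ μ ν} → κ ≐ μ → μ ≐ ν → κ ≐ ν
  ≐-trans e e′ r f = trans (e r f) (e′ r f)

  neighbours : State → Fin n → Fin n → Point → ℤ → ℤ
  neighbours κ s r f x =
    (x + κ s (f [ coord s r ]≔ (lookup f (coord s r) + 1ℤ))) + κ s (f [ coord s r ]≔ (lookup f (coord s r) - 1ℤ))

  -- The product of the commuting reflections in all nodes over `s`, in fundamental weight
  -- coordinates: the values there change sign, and their old values are added to the adjacent
  -- nodes.
  act : Fin n → State → State
  act s κ r f with r Fin.≟ s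
  ... | yes _ = - κ s f
  ... | no  _ = neighbours κ s r f (κ r f)

  act-same : ∀ s κ f → act s κ s f ≡ - κ s f
  act-same s κ f with s Fin.≟ s
  ... | yes _ = refl
  ... | no s≢s = contradiction refl s≢s

  act-other : ∀ {s r} → r ≢ s → ∀ κ f → act s κ r f ≡ neighbours κ s r f (κ r f)
  act-other {s} {r} r≢s κ f with r Fin.≟ s
  ... | yes r≡s = contradiction r≡s r≢s
  ... | no  _   = refl

  neighbours-line : ∀ κ s r {c} → c ≡ coord s r → ∀ f i x →
    neighbours κ s r (f [ c ]≔ i) x ≡ (x + κ s (f [ c ]≔ (i + 1ℤ))) + κ s (f [ c ]≔ (i - 1ℤ))
  neighbours-line κ s r {c} refl f i x rewrite lookup∘update c f i =
    cong₂ (λ y z → (x + κ s y) + κ s z) ([]≔-idempotent f c) ([]≔-idempotent f c)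

  act-line : ∀ {s r c} → c ≡ coord s r → r ≢ s → ∀ κ f i →
    act s κ r (f [ c ]≔ i) ≡ (κ r (f [ c ]≔ i) + κ s (f [ c ]≔ (i + 1ℤ))) + κ s (f [ c ]≔ (i - 1ℤ))
  act-line {s} {r} {c} c≡ r≢s κ f i = trans (act-other r≢s κ _) (neighbours-line κ s r c≡ f i (κ r (f [ c ]≔ i)))

  act-cong : ∀ s {κ μ} → κ ≐ μ → act s κ ≐ act s μ
  act-cong s e r f with r Fin.≟ s
  ... | yes _ = cong -_ (e s f)
  ... | no  _ = cong₂ _+_ (cong₂ _+_ (e r f) (e s _)) (e s _)

  act-involutive : ∀ s κ → act s (act s κ) ≐ κ
  act-involutive s κ r f with r Fin.≟ s
  ... | yes refl = trans (cong -_ (act-same s κ f)) (ℤ.neg-involutive (κ s f))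
  ... | no r≢s   = trans
    (cong₂ _+_ (cong₂ _+_ (act-other r≢s κ f) (act-same s κ _)) (act-same s κ _))
    (e (κ r f) _ _)
    where
    e : ∀ x y z → (((x + y) + z) + - y) + - z ≡ x
    e = solve-∀

  _⊕_ : State → State → State
  (κ ⊕ μ) r f = κ r f + μ r f

  act-⊕ : ∀ s κ μ → act s (κ ⊕ μ) ≐ act s κ ⊕ act s μ
  act-⊕ s κ μ r f with r Fin.≟ s
  ... | yes _ = ℤ.neg-distrib-+ (κ s f) (μ s f)
  ... | no  _ = e (κ r f) _ _ _ _ _
    where
    e : ∀ a b c a′ b′ c′ → ((a + a′) + (b + b′)) + (c + c′) ≡ ((a + b) + c) + ((a′ + b′) + c′)
    e = solve-∀

  actW : Word → State → State
  actW []      κ = κ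
  actW (s ∷ w) κ = act s (actW w κ)

  actW-++ : ∀ u v κ → actW (u ++ v) κ ≡ actW u (actW v κ)
  actW-++ []      v κ = refl
  actW-++ (s ∷ u) v κ = cong (act s) (actW-++ u v κ)

  actW-cong : ∀ w {κ μ} → κ ≐ μ → actW w κ ≐ actW w μ
  actW-cong []      e = e
  actW-cong (s ∷ w) e = act-cong s (actW-cong w e)

  actW-⊕ : ∀ w κ μ → actW w (κ ⊕ μ) ≐ actW w κ ⊕ actW w μ
  actW-⊕ []      κ μ r f = refl
  actW-⊕ (s ∷ w) κ μ = ≐-trans (act-cong s (actW-⊕ w κ μ)) (act-⊕ s (actW w κ) (actW w μ))

  record Proper (κ : State) : Set where
    constructor proper
    field
      antisym : ∀ c {a} → a ≡ 0ℤ ⊎ a ≡ + bd c + + bd c → ∀ r f → Antisym a (λ i → κ r (f [ c ]≔ i))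

  open Proper

  act-proper : ∀ s {κ} → Proper κ → Proper (act s κ)
  act-proper s {κ} P .antisym c {a} h r f i with r Fin.≟ s
  ... | yes _ = cong -_ (antisym P c h s f i)
  ... | no  _ with c Fin.≟ coord s r
  -- Reflecting the coordinate that joins `s` and `r` exchanges the two neighbours.
  ...   | yes c≡ = begin
    neighbours κ s r (f [ c ]≔ (a - i)) (κ r (f [ c ]≔ (a - i)))
      ≡⟨ neighbours-line κ s r c≡ f (a - i) (κ r (f [ c ]≔ (a - i))) ⟩
    (κ r (f [ c ]≔ (a - i)) + κ s (f [ c ]≔ ((a - i) + 1ℤ))) + κ s (f [ c ]≔ ((a - i) - 1ℤ))
      ≡⟨ cong₂ (λ x y → (κ r (f [ c ]≔ (a - i)) + κ s (f [ c ]≔ x)) + κ s (f [ c ]≔ y)) (e₁ a i) (e₂ a i) ⟩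
    (κ r (f [ c ]≔ (a - i)) + κ s (f [ c ]≔ (a - (i - 1ℤ)))) + κ s (f [ c ]≔ (a - (i + 1ℤ)))
      ≡⟨ cong₂ _+_ (cong₂ _+_ (antisym P c h r f i) (antisym P c h s f (i - 1ℤ))) (antisym P c h s f (i + 1ℤ)) ⟩
    (- κ r (f [ c ]≔ i) + - κ s (f [ c ]≔ (i - 1ℤ))) + - κ s (f [ c ]≔ (i + 1ℤ))
      ≡⟨ e₃ (κ r (f [ c ]≔ i)) _ _ ⟩
    - ((κ r (f [ c ]≔ i) + κ s (f [ c ]≔ (i + 1ℤ))) + κ s (f [ c ]≔ (i - 1ℤ)))
      ≡⟨ cong -_ (neighbours-line κ s r c≡ f i (κ r (f [ c ]≔ i))) ⟨
    - neighbours κ s r (f [ c ]≔ i) (κ r (f [ c ]≔ i)) ∎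
    where
    open ≡-Reasoning
    e₁ : ∀ a i → (a - i) + 1ℤ ≡ a - (i - 1ℤ)
    e₁ = solve-∀
    e₂ : ∀ a i → (a - i) - 1ℤ ≡ a - (i + 1ℤ)
    e₂ = solve-∀
    e₃ : ∀ x y z → (- x + - y) + - z ≡ - ((x + z) + y)
    e₃ = solve-∀
  -- Any other coordinate is updated independently of the step to the neighbours, so the reflection
  -- applies to each term.
  ...   | no c≢ = begin
    neighbours κ s r (f [ c ]≔ (a - i)) (κ r (f [ c ]≔ (a - i)))
      ≡⟨ off-line (a - i) ⟩
    (κ r (f [ c ]≔ (a - i)) + κ s (f₊ [ c ]≔ (a - i))) + κ s (f₋ [ c ]≔ (a - i))
      ≡⟨ cong₂ _+_ (cong₂ _+_ (antisym P c h r f i) (antisym P c h s f₊ i)) (antisym P c h s f₋ i) ⟩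
    (- κ r (f [ c ]≔ i) + - κ s (f₊ [ c ]≔ i)) + - κ s (f₋ [ c ]≔ i)
      ≡⟨ e₃ (κ r (f [ c ]≔ i)) _ _ ⟩
    - ((κ r (f [ c ]≔ i) + κ s (f₊ [ c ]≔ i)) + κ s (f₋ [ c ]≔ i))
      ≡⟨ cong -_ (off-line i) ⟨
    - neighbours κ s r (f [ c ]≔ i) (κ r (f [ c ]≔ i)) ∎
    where
    open ≡-Reasoning
    c′ = coord s r
    f₊ = f [ c′ ]≔ (lookup f c′ + 1ℤ)
    f₋ = f [ c′ ]≔ (lookup f c′ - 1ℤ)
    off-line : ∀ j → neighbours κ s r (f [ c ]≔ j) (κ r (f [ c ]≔ j))
                   ≡ (κ r (f [ c ]≔ j) + κ s (f₊ [ c ]≔ j)) + κ s (f₋ [ c ]≔ j)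
    off-line j rewrite lookup∘update′ (c≢ ∘ sym) f j =
      cong₂ (λ y z → (κ r (f [ c ]≔ j) + κ s y) + κ s z) ([]≔-commutes f c c′ c≢) ([]≔-commutes f c c′ c≢)
    e₃ : ∀ x y z → (- x + - y) + - z ≡ - ((x + y) + z)
    e₃ = solve-∀

  actW-proper : ∀ w {κ} → Proper κ → Proper (actW w κ)
  actW-proper []      P = P
  actW-proper (s ∷ w) P = act-proper s (actW-proper w P)

  -- The letter that follows the prefix `alt s t k` in the infinite alternating word.
  letter : Fin n → Fin n → ℕ → Fin n
  letter s t zero    = s
  letter s t (suc k) = letter t s k

  letter-≢ : ∀ {s t} → s ≢ t → ∀ k → letter s t k ≢ letter t s k
  letter-≢ s≢t zero    = s≢t
  letter-≢ s≢t (suc k) = letter-≢ (s≢t ∘ sym) k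

  letter-all : ∀ {p} (P : Fin n → Set p) {s t} → P s → P t → ∀ k → P (letter s t k)
  letter-all P Ps Pt zero    = Ps
  letter-all P Ps Pt (suc k) = letter-all P Pt Ps k

  alt-snoc : ∀ s t k → alt s t (suc k) ≡ alt s t k ++ [ letter s t k ]
  alt-snoc s t zero    = refl
  alt-snoc s t (suc k) = cong (s ∷_) (alt-snoc t s k)

  line : State → Fin n → Point → Fin (n ℕ.* n) → ℤ → ℤ
  line κ r f c i = κ r (f [ c ]≔ i)

  -- Along a line in direction {s , t} an alternating word evolves a state by the discrete wave equation.
  alt-wave : ∀ {s t} → s ≢ t → ∀ {c} → c ≡ coord s t → ∀ κ f k i →
    let W = wave (line κ (letter t s k) f c) (line κ (letter s t k) f c) in
    line (actW (alt s t k) κ) t f c i ≡ W (suc k) i × line (actW (alt s t k) κ) s f c i ≡ - W k i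
  alt-wave s≢t c≡ κ f zero i = refl , sym (ℤ.neg-involutive _)
  alt-wave {s} {t} s≢t {c} c≡ κ f (suc k) i =
    trans (act-line c≡ (s≢t ∘ sym) κ′ f i)
          (cong₂ _+_ (cong₂ _+_ (proj₂ (IH i)) (proj₁ (IH (i + 1ℤ)))) (proj₁ (IH (i - 1ℤ))))
    , trans (act-same s κ′ _) (cong -_ (proj₁ (IH i)))
    where
    κ′ = actW (alt t s k) κ
    IH = alt-wave (s≢t ∘ sym) (trans c≡ (coord-comm s t)) κ f k

  -- Braid relations in the representation

  module Dihedral {s t : Fin n} (s≢t : s ≢ t) {κ : State} (P : Proper κ) where

    private
      c = coord s t

    -- By `alt-wave` these are time slices m+1 and m. Gliding back by m turns them into slices 1 and
    -- 0, which are the initial data up to sign.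
    alt-m : ∀ f →
      actW (alt s t (m s t)) κ t f ≡ κ (letter t s (m s t)) (f [ c ]≔ (- + m s t + lookup f c)) ×
      actW (alt s t (m s t)) κ s f ≡ κ (letter s t (m s t)) (f [ c ]≔ (- + m s t + lookup f c))
    alt-m f rewrite sym (bd-coord s≢t) =
        (begin
          actW A κ t f                        ≡⟨ cong (actW A κ t) ([]≔-lookup f c) ⟨
          line (actW A κ) t f c i             ≡⟨ proj₁ (alt-wave s≢t refl κ f k i) ⟩
          W (suc k) i                         ≡⟨ cong₂ W (ℕ.+-comm 1 k) (e (+ k) i) ⟩
          W (k ℕ.+ 1) (+ k + (- + k + i))     ≡⟨ glide 1 (- + k + i) ⟩
          κ (letter t s k) (f [ c ]≔ (- + k + i)) ∎)
      , (begin
          actW A κ s f                        ≡⟨ cong (actW A κ s) ([]≔-lookup f c) ⟨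
          line (actW A κ) s f c i             ≡⟨ proj₂ (alt-wave s≢t refl κ f k i) ⟩
          - W k i                             ≡⟨ cong -_ (cong₂ W (sym (ℕ.+-identityʳ k)) (e (+ k) i)) ⟩
          - W (k ℕ.+ 0) (+ k + (- + k + i))   ≡⟨ cong -_ (glide 0 (- + k + i)) ⟩
          - - κ (letter s t k) (f [ c ]≔ (- + k + i)) ≡⟨ ℤ.neg-involutive _ ⟩
          κ (letter s t k) (f [ c ]≔ (- + k + i)) ∎)
      where
      open ≡-Reasoning
      k = bd c
      A = alt s t k
      i = lookup f c
      W = wave (line κ (letter t s k) f c) (line κ (letter s t k) f c)
      glide = Bounded.wave-glide k
        {line κ (letter t s k) f c} {line κ (letter s t k) f c}
        (antisym P c (inj₁ refl) _ f) (antisym P c (inj₂ refl) _ f)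
        (antisym P c (inj₁ refl) _ f) (antisym P c (inj₂ refl) _ f)
      e : ∀ k i → i ≡ k + (- k + i)
      e = solve-∀

  module Braid {s t : Fin n} (s≢t : s ≢ t) {κ : State} (P : Proper κ) where

    -- `alt-m` for the two orders of the pair arrives at the same letter and the same shifted point.
    braid-t : ∀ f → actW (alt s t (m s t)) κ t f ≡ actW (alt t s (m s t)) κ t f
    braid-t f = trans (proj₁ (Dihedral.alt-m s≢t P f)) (sym eq)
      where
      eq : actW (alt t s (m s t)) κ t f ≡
           κ (letter t s (m s t)) (f [ coord s t ]≔ (- + m s t + lookup f (coord s t)))
      eq rewrite symm s t | coord-comm s t = proj₂ (Dihedral.alt-m (s≢t ∘ sym) P f)

    braid-s : ∀ f → actW (alt s t (m s t)) κ s f ≡ actW (alt t s (m s t)) κ s f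
    braid-s f = trans (proj₂ (Dihedral.alt-m s≢t P f)) (sym eq)
      where
      eq : actW (alt t s (m s t)) κ s f ≡
           κ (letter s t (m s t)) (f [ coord s t ]≔ (- + m s t + lookup f (coord s t)))
      eq rewrite symm s t | coord-comm s t = proj₁ (Dihedral.alt-m (s≢t ∘ sym) P f)

  act-fix : ∀ {s κ} → (∀ f → κ s f ≡ 0ℤ) → act s κ ≐ κ
  act-fix {s} {κ} z r f with r Fin.≟ s
  ... | yes refl = trans (cong -_ (z f)) (sym (z f))
  ... | no  _    = trans (cong₂ _+_ (cong (λ y → κ r f + y) (z _)) (z _)) (trans (ℤ.+-identityʳ _) (ℤ.+-identityʳ _))

  -- With A = alt s t m, A′ = alt t s m and a the letter continuing A, one has A a = s A′ and A′ a = s A.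
  -- A state fixed by a is thus moved by A and A′ alike.
  braid-fixed : ∀ {s t} → s ≢ t → 1 ℕ.≤ m s t → ∀ {κ} → Proper κ →
    (∀ f → κ (letter s t (m s t)) f ≡ 0ℤ) →
    ∀ {r} → r ≢ s → ∀ f → actW (alt s t (m s t)) κ r f ≡ actW (alt t s (m s t)) κ r f
  braid-fixed {s} {t} s≢t 1≤m {κ} P z {r} r≢s f = half (Aa≐sA′ r f) (A′a≐sA r f)
    where
    open ≡-Reasoning
    A  = actW (alt s t (m s t)) κ
    A′ = actW (alt t s (m s t)) κ
    fixed : act (letter s t (m s t)) κ ≐ κ
    fixed = act-fix z
    Aa≐sA′ : A ≐ act s A′
    Aa≐sA′ = ≐-trans (actW-cong (alt s t (m s t)) (≐-sym fixed))
      (λ r f → cong (λ κ → κ r f) (trans (sym (actW-++ (alt s t (m s t)) [ _ ] κ))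
        (cong (λ w → actW w κ) (sym (alt-snoc s t (m s t))))))
    snoc-cancel : ∀ k → 1 ℕ.≤ k → actW (alt t s k) (act (letter s t k) κ) ≐ act s (actW (alt s t k) κ)
    snoc-cancel (suc k) _ = ≐-trans
      (λ r f → cong (λ κ → κ r f) (trans (cong (λ w → actW w (act (letter t s k) κ)) (alt-snoc t s k))
        (actW-++ (alt t s k) [ _ ] _)))
      (≐-trans (actW-cong (alt t s k) (act-involutive _ κ)) (≐-sym (act-involutive s _)))
    A′a≐sA : A′ ≐ act s A
    A′a≐sA = ≐-trans (actW-cong (alt t s (m s t)) (≐-sym fixed)) (snoc-cancel (m s t) 1≤m)
    -- Over `r` the two states differ by the neighbour sum `S` taken over `s`. Since they agree over
    -- `s`, each equals the other plus the same `S`, whence `S` is its own negative.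
    half : A r f ≡ act s A′ r f → A′ r f ≡ act s A r f → A r f ≡ A′ r f
    half e e′ = begin
      A r f                     ≡⟨ x≡y+S ⟩
      A′ r f + S                ≡⟨ cong (λ z → A′ r f + z) S≡0 ⟩
      A′ r f + 0ℤ               ≡⟨ ℤ.+-identityʳ _ ⟩
      A′ r f                    ∎
      where
      S = A′ s (f [ coord s r ]≔ (lookup f (coord s r) + 1ℤ)) + A′ s (f [ coord s r ]≔ (lookup f (coord s r) - 1ℤ))
      x≡y+S : A r f ≡ A′ r f + S
      x≡y+S = trans e (trans (act-other r≢s A′ f) (ℤ.+-assoc (A′ r f) _ _))
      y≡x+S : A′ r f ≡ A r f + S
      y≡x+S = trans e′ (trans (act-other r≢s A f) (trans (ℤ.+-assoc (A r f) _ _)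
        (cong (λ z → A r f + z) (cong₂ _+_ (Braid.braid-s s≢t P _) (Braid.braid-s s≢t P _)))))
      cancel : ∀ x S → x ≡ (x + S) + S → S ≡ - S
      cancel x S e = trans (l x S) (trans (cong (λ z → - S + (z - x)) (sym e)) (l′ x S))
        where
        l : ∀ x S → S ≡ - S + (((x + S) + S) - x)
        l = solve-∀
        l′ : ∀ x S → - S + (x - x) ≡ - S
        l′ = solve-∀
      S≡0 : S ≡ 0ℤ
      S≡0 = i≡-i⇒i≡0 (cancel (A r f) S (trans x≡y+S (cong (_+ S) y≡x+S)))

  select : (Fin n → Bool) → State → State
  select p κ r f = if p r then κ r f else 0ℤ

  select-proper : ∀ p {κ} → Proper κ → Proper (select p κ)
  select-proper p P .antisym c h r f i with p r
  ... | true  = antisym P c h r f i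
  ... | false = refl

  -- Over `s` and `t` the glide decides. Over a third generator the state is split into its part off
  -- the continuing letter `a` and its part over `a`. The first vanishes over `a`, the second over
  -- the other letter, so `braid-fixed` covers both, with `s` and `t` exchanged for the second.
  act-braid : ∀ s t → 1 ℕ.≤ m s t → ∀ {κ} → Proper κ →
              actW (alt s t (m s t)) κ ≐ actW (alt t s (m s t)) κ
  act-braid s t 1≤m {κ} P r f with s Fin.≟ t
  ... | yes refl = refl
  ... | no s≢t with r Fin.≟ s | r Fin.≟ t
  ...   | yes refl | _        = Braid.braid-s s≢t P f
  ...   | no _     | yes refl = Braid.braid-t s≢t P f
  ...   | no r≢s   | no r≢t   = begin
    actW A κ r f                              ≡⟨ actW-cong A split r f ⟩
    actW A (κ₁ ⊕ κ₂) r f                      ≡⟨ actW-⊕ A κ₁ κ₂ r f ⟩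
    actW A κ₁ r f + actW A κ₂ r f             ≡⟨ cong₂ _+_ (braid-fixed s≢t 1≤m (select-proper p₁ P) z₁ r≢s f) eq₂ ⟩
    actW A′ κ₁ r f + actW A′ κ₂ r f           ≡⟨ actW-⊕ A′ κ₁ κ₂ r f ⟨
    actW A′ (κ₁ ⊕ κ₂) r f                     ≡⟨ actW-cong A′ split r f ⟨
    actW A′ κ r f ∎
    where
    open ≡-Reasoning
    A  = alt s t (m s t)
    A′ = alt t s (m s t)
    a = letter s t (m s t)
    p₁ p₂ : Fin n → Bool
    p₂ r = does (r Fin.≟ a)
    p₁ r = if p₂ r then false else true
    κ₁ = select p₁ κ
    κ₂ = select p₂ κ
    split : κ ≐ κ₁ ⊕ κ₂
    split r f with does (r Fin.≟ a)
    ... | true  = sym (ℤ.+-identityˡ _)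
    ... | false = sym (ℤ.+-identityʳ _)
    z₁ : ∀ f → κ₁ a f ≡ 0ℤ
    z₁ f with a Fin.≟ a
    ... | yes _ = refl
    ... | no ¬p = contradiction refl ¬p
    z₂ : ∀ f → κ₂ (letter t s (m s t)) f ≡ 0ℤ
    z₂ f with letter t s (m s t) Fin.≟ a
    ... | yes e = contradiction (sym e) (letter-≢ s≢t (m s t))
    ... | no _  = refl
    eq₂ : actW A κ₂ r f ≡ actW A′ κ₂ r f
    eq₂ = sym (swap (symm s t))
      where
      swap : m s t ≡ m t s → actW A′ κ₂ r f ≡ actW A κ₂ r f
      swap e = subst (λ k → actW (alt t s k) κ₂ r f ≡ actW (alt s t k) κ₂ r f) (sym e)
        (braid-fixed (s≢t ∘ sym) (subst (1 ℕ.≤_) e 1≤m) (select-proper p₂ P)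
          (subst (λ k → ∀ f → κ₂ (letter t s k) f ≡ 0ℤ) e z₂) r≢t f)

  actW-≈ : ∀ {u v} → u ≈ v → ∀ {κ} → Proper κ → actW u κ ≐ actW v κ
  actW-≈ ≈-refl        P r f = refl
  actW-≈ (≈-sym e)     P = ≐-sym (actW-≈ e P)
  actW-≈ (≈-trans e f) P = ≐-trans (actW-≈ e P) (actW-≈ f P)
  actW-≈ (≈-step u {l} {r} v rel) {κ} P i f
    rewrite actW-++ u (l ++ v) κ | actW-++ l v κ | actW-++ u (r ++ v) κ | actW-++ r v κ
    = actW-cong u (rel-≐ rel) i f
    where
    rel-≐ : ∀ {l r} → Rel l r → actW l (actW v κ) ≐ actW r (actW v κ)
    rel-≐ (invol s)       = act-involutive s _
    rel-≐ (braid s t 1≤m) = act-braid s t 1≤m (actW-proper v P)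

  -- Dominant weights

  record Fundamental (f : Point) : Set where
    constructor fundamental
    field
      interior : ∀ c → Interior (bd c) (lookup f c)

  open Fundamental

  fundamental-line : ∀ {f} → Fundamental f → ∀ c {i} → Interior (bd c) i → Fundamental (f [ c ]≔ i)
  fundamental-line {f} F c {i} int .interior c′ with c′ Fin.≟ c
  ... | yes refl = subst (Interior (bd c)) (sym (lookup∘update c f i)) int
  ... | no c′≢c  = subst (Interior (bd c′)) (sym (lookup∘update′ c′≢c f i)) (interior F c′)

  base : Point
  base = replicate _ 1ℤ

  base-fundamental : Fundamental base
  base-fundamental .interior c = subst (Interior (bd c)) (sym (lookup-replicate c 1ℤ))
    (0 , refl , 0or>1 (uncurry m (remQuot {n} n c)))
    where
    0or>1 : ∀ k → bound k ≡ 0 ⊎ 1 ℕ.< bound k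
    0or>1 0             = inj₁ refl
    0or>1 1             = inj₁ refl
    0or>1 (suc (suc k)) = inj₂ (s≤s (s≤s z≤n))

  σ : Point → ℤ
  σ = bumps bd

  ρ : State
  ρ _ = σ

  ρ-proper : Proper ρ
  ρ-proper .antisym c h _ f = bumps-antisym bd c h f

  -- A stand-in for the fundamental weight of `s`: dominant, and fixed by every other generator.
  ω : Fin n → State
  ω s = select (λ r → does (r Fin.≟ s)) ρ

  ω-proper : ∀ s → Proper (ω s)
  ω-proper s = select-proper _ ρ-proper

  ω-same : ∀ s f → ω s s f ≡ σ f
  ω-same s f with s Fin.≟ s
  ... | yes _ = refl
  ... | no ¬p = contradiction refl ¬p

  ω-other : ∀ {s r} → r ≢ s → ∀ f → ω s r f ≡ 0ℤ
  ω-other {s} {r} r≢s f with r Fin.≟ s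
  ... | yes e = contradiction e r≢s
  ... | no _  = refl

-- Word calculus and the alternative of positivity or descent

module CoxeterGroup {n : ℕ} (M : CoxeterMatrix n) where

  open CoxeterMatrix M
  open Coxeter M
  open Representation M

  ≡⇒≈ : ∀ {u v} → u ≡ v → u ≈ v
  ≡⇒≈ refl = ≈-refl

  ≈-++ˡ : ∀ w {u v} → u ≈ v → w ++ u ≈ w ++ v
  ≈-++ˡ w ≈-refl        = ≈-refl
  ≈-++ˡ w (≈-sym e)     = ≈-sym (≈-++ˡ w e)
  ≈-++ˡ w (≈-trans e f) = ≈-trans (≈-++ˡ w e) (≈-++ˡ w f)
  ≈-++ˡ w (≈-step u {l} {r} v rel) = subst₂ _≈_ (List.++-assoc w u _) (List.++-assoc w u _) (≈-step (w ++ u) v rel)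

  ≈-++ʳ : ∀ w {u v} → u ≈ v → u ++ w ≈ v ++ w
  ≈-++ʳ w ≈-refl        = ≈-refl
  ≈-++ʳ w (≈-sym e)     = ≈-sym (≈-++ʳ w e)
  ≈-++ʳ w (≈-trans e f) = ≈-trans (≈-++ʳ w e) (≈-++ʳ w f)
  ≈-++ʳ w (≈-step u {l} {r} v rel) = subst₂ _≈_ (assoc l) (assoc r) (≈-step u (v ++ w) rel)
    where
    assoc : ∀ l → u ++ l ++ v ++ w ≡ (u ++ l ++ v) ++ w
    assoc l = trans (cong (u ++_) (sym (List.++-assoc l v w))) (sym (List.++-assoc u (l ++ v) w))

  ≈-∷ : ∀ s {u v} → u ≈ v → s ∷ u ≈ s ∷ v
  ≈-∷ s = ≈-++ˡ [ s ]

  ≈-cancel : ∀ s w → s ∷ s ∷ w ≈ w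
  ≈-cancel s w = ≈-step [] w (invol s)

  ≈-flip : ∀ {s u v} → s ∷ u ≈ v → u ≈ s ∷ v
  ≈-flip {s} {u} e = ≈-trans (≈-sym (≈-cancel s u)) (≈-∷ s e)

  ≈-snoc-cancel : ∀ w s → (w ++ [ s ]) ++ [ s ] ≈ w
  ≈-snoc-cancel w s = subst₂ _≈_ (sym (List.++-assoc w [ s ] [ s ])) (List.++-identityʳ w) (≈-step w [] (invol s))

  letter-cases : ∀ s t k → (letter s t k ≡ s × letter t s k ≡ t) ⊎ (letter s t k ≡ t × letter t s k ≡ s)
  letter-cases s t zero    = inj₁ (refl , refl)
  letter-cases s t (suc k) with letter-cases s t k
  ... | inj₁ (e , e′) = inj₂ (e′ , e)
  ... | inj₂ (e , e′) = inj₁ (e′ , e)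

  letter-letter : ∀ s t k → letter (letter s t k) (letter t s k) k ≡ s
  letter-letter s t zero    = refl
  letter-letter s t (suc k) = letter-letter s t k

  reverse-alt : ∀ s t k → reverse (alt s t k) ≡ alt (letter t s k) (letter s t k) k
  reverse-alt s t zero    = refl
  reverse-alt s t (suc k) = begin
    reverse (s ∷ alt t s k)                            ≡⟨ List.unfold-reverse s (alt t s k) ⟩
    reverse (alt t s k) ++ [ s ]
      ≡⟨ cong₂ (λ u x → u ++ [ x ]) (reverse-alt t s k) (sym (letter-letter s t k)) ⟩
    alt x y k ++ [ letter x y k ]                      ≡⟨ alt-snoc x y k ⟨
    alt x y (suc k) ∎
    where
    open ≡-Reasoning
    x = letter s t k
    y = letter t s k

  length-alt : ∀ s t k → length (alt s t k) ≡ k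
  length-alt s t zero    = refl
  length-alt s t (suc k) = cong suc (length-alt t s k)

  alt-+ : ∀ s t j k → alt s t (j ℕ.+ k) ≡ alt s t j ++ alt (letter s t j) (letter t s j) k
  alt-+ s t zero    k = refl
  alt-+ s t (suc j) k = cong (s ∷_) (alt-+ t s j k)

  alt-all : ∀ {K : Fin n → Set} {s t} → K s → K t → ∀ k → All K (alt s t k)
  alt-all Ks Kt zero    = []
  alt-all Ks Kt (suc k) = Ks ∷ alt-all Kt Ks k

  ≈-reverse : ∀ {u v} → u ≈ v → reverse u ≈ reverse v
  ≈-reverse ≈-refl        = ≈-refl
  ≈-reverse (≈-sym e)     = ≈-sym (≈-reverse e)
  ≈-reverse (≈-trans e f) = ≈-trans (≈-reverse e) (≈-reverse f)
  ≈-reverse (≈-step u {l} {r} v rel) = subst₂ _≈_ (rev l) (rev r)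
    (≈-++ˡ (reverse v) (≈-++ʳ (reverse u) (rel-reverse rel)))
    where
    rev : ∀ l → reverse v ++ reverse l ++ reverse u ≡ reverse (u ++ l ++ v)
    rev l = sym (trans (List.reverse-++ u (l ++ v))
      (trans (cong (_++ reverse u) (List.reverse-++ l v)) (List.++-assoc (reverse v) (reverse l) (reverse u))))
    rel-reverse : ∀ {l r} → Rel l r → reverse l ≈ reverse r
    rel-reverse (invol s) = ≈-cancel s []
    rel-reverse (braid s t 1≤m) rewrite reverse-alt s t (m s t) | reverse-alt t s (m s t)
      with letter s t (m s t) | letter t s (m s t) | letter-cases s t (m s t)
    ... | _ | _ | inj₁ (refl , refl) =
      ≈-sym (subst₂ _≈_ (List.++-identityʳ _) (List.++-identityʳ _) (≈-step [] [] (braid s t 1≤m)))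
    ... | _ | _ | inj₂ (refl , refl) =
      subst₂ _≈_ (List.++-identityʳ _) (List.++-identityʳ _) (≈-step [] [] (braid s t 1≤m))

  parity : Word → Bool
  parity []      = false
  parity (s ∷ w) = not (parity w)

  parity-++ : ∀ u {v w} → parity v ≡ parity w → parity (u ++ v) ≡ parity (u ++ w)
  parity-++ []      e = e
  parity-++ (s ∷ u) e = cong not (parity-++ u e)

  parity-≈ : ∀ {u v} → u ≈ v → parity u ≡ parity v
  parity-≈ ≈-refl        = refl
  parity-≈ (≈-sym e)     = sym (parity-≈ e)
  parity-≈ (≈-trans e f) = trans (parity-≈ e) (parity-≈ f)
  parity-≈ (≈-step u v (invol s))     = parity-++ u (Bool.not-involutive (parity v))
  parity-≈ (≈-step u v (braid s t _)) = parity-++ u (swap s t (m s t))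
    where
    swap : ∀ s t k → parity (alt s t k ++ v) ≡ parity (alt t s k ++ v)
    swap s t zero    = refl
    swap s t (suc k) = cong not (swap t s k)

  -- The analogue of the theorem that w sends a simple root to a positive or a negative root: a word
  -- over `K` keeps the state positive over `s`, or it can be rewritten over `K` with `s` split off
  -- and a shorter remainder. It is used for strict and weak positivity, and for a proper set `K`.
  module Positivity (K : Fin n → Set) {G : ℤ → Set} (G-+ : ∀ {x y} → G x → G y → G (x + y))
    {κ : State} (P : Proper κ) (dominant : ∀ {r} → K r → ∀ {f} → Fundamental f → G (κ r f)) where

    Pos : Word → Fin n → Set
    Pos w s = ∀ {f} → Fundamental f → G (actW w κ s f)

    Drop : Word → Fin n → Set
    Drop w s = ∃[ w′ ] (w ≈ s ∷ w′ × All K w′ × length w′ ℕ.< length w)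

    Pos-≈ : ∀ {u v s} → u ≈ v → Pos u s → Pos v s
    Pos-≈ {s = s} e p {f} F = subst G (actW-≈ e P s f) (p F)

    private
      transfer : ∀ {u v s} → u ≈ v → length u ℕ.≤ length v → Pos u s ⊎ Drop u s → Pos v s ⊎ Drop v s
      transfer e le (inj₁ p)                = inj₁ (Pos-≈ e p)
      transfer e le (inj₂ (w′ , d , k , l)) = inj₂ (w′ , ≈-trans (≈-sym e) d , k , ℕ.<-≤-trans l le)

    -- The value is a wave at time `suc k`, with data taken from `x` applied to the state; these
    -- data are positive inside the string, and the wave stays positive up to time m.
    Pos-alt : ∀ {s t} → s ≢ t → ∀ k x → m s t ≡ 0 ⊎ k ℕ.< m s t → Pos x s → Pos x t → Pos (alt t s k ++ x) s
    Pos-alt {s} {t} s≢t k x bnd ps pt {f} F = subst G (sym eq)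
      (Positive.wave-positive {G} G-+ (bd c)
        (antisym Px c (inj₁ refl) (letter s t k) f) (antisym Px c (inj₂ refl) (letter s t k) f)
        (antisym Px c (inj₁ refl) (letter t s k) f) (antisym Px c (inj₂ refl) (letter t s k) f)
        (λ int → letter-all (λ r → Pos x r) ps pt k (fundamental-line F c int))
        (λ int → letter-all (λ r → Pos x r) pt ps k (fundamental-line F c int))
        k (subst (λ b → b ≡ 0 ⊎ k ℕ.< b) (sym (trans (bd-coord (s≢t ∘ sym)) (symm t s))) bnd) (interior F c))
      where
      open Proper
      open Fundamental
      open ≡-Reasoning
      c = coord t s
      i = lookup f c
      κ′ = actW x κ
      Px = actW-proper x P
      eq : actW (alt t s k ++ x) κ s f ≡ wave (line κ′ (letter s t k) f c) (line κ′ (letter t s k) f c) (suc k) i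
      eq = begin
        actW (alt t s k ++ x) κ s f          ≡⟨ cong (λ μ → μ s f) (actW-++ (alt t s k) x κ) ⟩
        actW (alt t s k) κ′ s f              ≡⟨ cong (actW (alt t s k) κ′ s) ([]≔-lookup f c) ⟨
        line (actW (alt t s k) κ′) s f c i   ≡⟨ proj₁ (alt-wave (s≢t ∘ sym) refl κ′ f k i) ⟩
        wave (line κ′ (letter s t k) f c) (line κ′ (letter t s k) f c) (suc k) i ∎

    private
      module Peel {s t : Fin n} (s≢t : s ≢ t) (Ks : K s) (Kt : K t) {w : Word}
        (IH : ∀ x → length x ℕ.< length w → All K x → ∀ r → K r → Pos x r ⊎ Drop x r) where

        -- The first m letters of the alternating prefix are braided so that they begin with `s`.
        overshoot : ∀ k x → w ≈ alt t s k ++ x → k ℕ.+ length x ℕ.≤ length w → All K x →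
                    ∀ m′ → m s t ≡ suc m′ → m s t ℕ.≤ k → Drop w s
        overshoot k x w≈ le Kx m′ eq m≤k with ℕ.m≤n⇒∃[o]m+o≡n m≤k
        ... | j , refl = alt t s m′ ++ rest ++ x , w≈′ , All.++⁺ (alt-all Kt Ks m′) (All.++⁺ Krest Kx) ,
            ℕ.≤-trans (ℕ.≤-reflexive len) le
          where
          rest = alt (letter t s (m s t)) (letter s t (m s t)) j
          Krest = alt-all (letter-all K Kt Ks (m s t)) (letter-all K Ks Kt (m s t)) j
          split : alt t s (m s t ℕ.+ j) ++ x ≡ alt t s (m s t) ++ rest ++ x
          split = trans (cong (_++ x) (alt-+ t s (m s t) j)) (List.++-assoc (alt t s (m s t)) rest x)
          w≈′ : w ≈ s ∷ alt t s m′ ++ rest ++ x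
          w≈′ = ≈-trans w≈ (≈-trans (≡⇒≈ split) (≈-trans
            (≈-sym (≈-step [] (rest ++ x) (braid s t (subst (1 ℕ.≤_) (sym eq) (s≤s z≤n)))))
            (≡⇒≈ (cong (λ k → alt s t k ++ rest ++ x) eq))))
          open ≡-Reasoning
          len : suc (length (alt t s m′ ++ rest ++ x)) ≡ (m s t ℕ.+ j) ℕ.+ length x
          len = begin
            suc (length (alt t s m′ ++ rest ++ x))
              ≡⟨ cong suc (List.length-++ (alt t s m′)) ⟩
            suc (length (alt t s m′) ℕ.+ length (rest ++ x))
              ≡⟨ cong₂ (λ a b → suc (a ℕ.+ b)) (length-alt t s m′)
                   (trans (List.length-++ rest) (cong (ℕ._+ length x) (length-alt _ _ j))) ⟩
            suc m′ ℕ.+ (j ℕ.+ length x)    ≡⟨ cong (ℕ._+ (j ℕ.+ length x)) eq ⟨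
            m s t ℕ.+ (j ℕ.+ length x)     ≡⟨ ℕ.+-assoc (m s t) j (length x) ⟨
            (m s t ℕ.+ j) ℕ.+ length x ∎

        finish : ∀ k x → w ≈ alt t s k ++ x → k ℕ.+ length x ℕ.≤ length w → All K x →
                 Pos x s → Pos x t → Pos w s ⊎ Drop w s
        finish k x w≈ le Kx ps pt with m s t in eq
        ... | zero = inj₁ (Pos-≈ (≈-sym w≈) (Pos-alt s≢t k x (inj₁ eq) ps pt))
        ... | suc m′ with k ℕ.<? m s t
        ...   | yes k<m = inj₁ (Pos-≈ (≈-sym w≈) (Pos-alt s≢t k x (inj₂ k<m) ps pt))
        ...   | no  k≮m = inj₂ (overshoot k x w≈ le Kx m′ eq (ℕ.≮⇒≥ k≮m))

        -- An alternating prefix of `w` is lengthened as far as possible. If `x` drops the last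
        -- letter of the prefix, that letter cancels and `w` gets shorter. If `x` drops the next
        -- letter, the prefix grows. Otherwise `x` is positive over both `s` and `t`, and the length
        -- of the prefix compared with m decides.
        peel : ∀ fuel k x → length x ℕ.≤ fuel → w ≈ alt t s (suc k) ++ x →
               suc k ℕ.+ length x ℕ.≤ length w → All K x →
               Pos w s ⊎ Drop w s
        peel fuel k x x≤ w≈ le Kx
          with IH x (ℕ.≤-trans (s≤s (ℕ.m≤n+m (length x) k)) le) Kx (letter s t k) (letter-all K Ks Kt k)
             | IH x (ℕ.≤-trans (s≤s (ℕ.m≤n+m (length x) k)) le) Kx (letter t s k) (letter-all K Kt Ks k)
        ... | inj₁ p | inj₁ p′ = uncurry (finish (suc k) x w≈ le Kx) (positives (letter-cases s t k))
          where
          positives : _ → Pos x s × Pos x t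
          positives (inj₁ (e , e′)) = subst (λ r → Pos x r) e p , subst (λ r → Pos x r) e′ p′
          positives (inj₂ (e , e′)) = subst (λ r → Pos x r) e′ p′ , subst (λ r → Pos x r) e p
        ... | _ | inj₂ (x′ , x≈ , Kx′ , lt) =
            transfer (≈-sym w≈′) (ℕ.<⇒≤ shorter) (IH (alt t s k ++ x′) shorter (All.++⁺ (alt-all Kt Ks k) Kx′) s Ks)
          where
          w≈′ : w ≈ alt t s k ++ x′
          w≈′ = ≈-trans w≈ (≈-trans (≈-++ˡ (alt t s (suc k)) x≈) (≈-trans
            (≡⇒≈ (trans (cong (_++ letter t s k ∷ x′) (alt-snoc t s k))
                        (List.++-assoc (alt t s k) [ letter t s k ] _)))
            (≈-++ˡ (alt t s k) (≈-cancel (letter t s k) x′))))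
          shorter : length (alt t s k ++ x′) ℕ.< length w
          shorter = ℕ.≤-trans (s≤s (ℕ.≤-trans
            (ℕ.≤-reflexive (trans (List.length-++ (alt t s k)) (cong (ℕ._+ length x′) (length-alt t s k))))
            (ℕ.+-monoʳ-≤ k (ℕ.<⇒≤ lt)))) le
        peel zero k x x≤ w≈ le Kx | inj₂ (x′ , x≈ , Kx′ , lt) | inj₁ _ =
          ⊥-elim (ℕ.n≮0 (ℕ.<-≤-trans lt x≤))
        peel (suc fuel) k x x≤ w≈ le Kx | inj₂ (x′ , x≈ , Kx′ , lt) | inj₁ _ =
          peel fuel (suc k) x′ (ℕ.≤-pred (ℕ.<-≤-trans lt x≤)) w≈′
            (ℕ.≤-trans (ℕ.≤-reflexive (sym (ℕ.+-suc (suc k) (length x′))))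
              (ℕ.≤-trans (ℕ.+-monoʳ-≤ (suc k) lt) le)) Kx′
          where
          w≈′ : w ≈ alt t s (suc (suc k)) ++ x′
          w≈′ = ≈-trans w≈ (≈-trans (≈-++ˡ (alt t s (suc k)) x≈)
            (≡⇒≈ (trans (sym (List.++-assoc (alt t s (suc k)) [ letter s t k ] x′))
                        (cong (_++ x′) (sym (alt-snoc t s (suc k)))))))

      bounded : ∀ N w → length w ℕ.≤ N → All K w → ∀ s → K s → Pos w s ⊎ Drop w s
      bounded N       []      _        _         s Ks = inj₁ (dominant Ks)
      bounded (suc N) (t ∷ w) (s≤s le) (Kt ∷ Kw) s Ks = cases (s Fin.≟ t)
        where
        cases : Dec (s ≡ t) → Pos (t ∷ w) s ⊎ Drop (t ∷ w) s
        cases (yes refl) = inj₂ (w , ≈-refl , Kw , ℕ.≤-refl)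
        cases (no s≢t)   = Peel.peel s≢t Ks Kt
          (λ x lt Kx r Kr → bounded N x (ℕ.≤-trans (ℕ.≤-pred lt) le) Kx r Kr)
          (length w) 0 w ℕ.≤-refl ≈-refl ℕ.≤-refl Kw

    pos⊎drop : ∀ {w} → All K w → ∀ {s} → K s → Pos w s ⊎ Drop w s
    pos⊎drop {w} Kw {s} Ks = bounded (length w) w ℕ.≤-refl Kw s Ks

  -- Existence of lengths

  σ-positive : ∀ {f} → Fundamental f → 0ℤ ℤ.< σ f
  σ-positive {f} F = bumps-positive bd f (Fundamental.interior F)

  -- One step from an interior point stays inside or lands on a reflecting end, where `σ` vanishes.
  σ-line-nonneg : ∀ {f} → Fundamental f → ∀ c →
    0ℤ ℤ.≤ σ (f [ c ]≔ (lookup f c + 1ℤ)) × 0ℤ ℤ.≤ σ (f [ c ]≔ (lookup f c - 1ℤ))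
  σ-line-nonneg {f} F c with Fundamental.interior F c
  ... | j , eq , bnd rewrite eq = up bnd , down j bnd
    where
    zero-at : ∀ {i} → bumps bd (f [ c ]≔ i) ≡ - bumps bd (f [ c ]≔ i) → 0ℤ ℤ.≤ σ (f [ c ]≔ i)
    zero-at e = ℤ.≤-reflexive (sym (i≡-i⇒i≡0 e))
    inside : ∀ j → bd c ≡ 0 ⊎ suc j ℕ.< bd c → 0ℤ ℤ.≤ σ (f [ c ]≔ + suc j)
    inside j b = ℤ.<⇒≤ (σ-positive (fundamental-line F c (j , refl , b)))
    e : ∀ x → (+ x + + x) - + x ≡ + x
    e x = trans (ℤ.+-assoc (+ x) (+ x) (- + x)) (trans (cong (λ z → + x + z) (ℤ.+-inverseʳ (+ x))) (ℤ.+-identityʳ (+ x)))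
    up : bd c ≡ 0 ⊎ suc j ℕ.< bd c → 0ℤ ℤ.≤ σ (f [ c ]≔ (+ suc j + 1ℤ))
    up b rewrite ℕ.+-comm j 1 with b
    ... | inj₁ z = inside (suc j) (inj₁ z)
    ... | inj₂ lt with ℕ.m≤n⇒m<n∨m≡n lt
    ...   | inj₁ lt′ = inside (suc j) (inj₂ lt′)
    ...   | inj₂ refl′ = zero-at (subst (λ x → σ (f [ c ]≔ + x) ≡ - σ (f [ c ]≔ + x)) (sym refl′)
              (trans (cong (λ x → σ (f [ c ]≔ x)) (sym (e (bd c)))) (bumps-antisym bd c (inj₂ refl) f (+ bd c))))
    down : ∀ j → bd c ≡ 0 ⊎ suc j ℕ.< bd c → 0ℤ ℤ.≤ σ (f [ c ]≔ (+ suc j - 1ℤ))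
    down zero    b = zero-at (bumps-antisym bd c (inj₁ refl) f 0ℤ)
    down (suc j) b = inside j ([ inj₁ , inj₂ ∘ ℕ.<⇒≤ ]′ b)

  module Strict = Positivity (λ _ → ⊤) {λ x → 0ℤ ℤ.< x} ℤ.+-mono-< ρ-proper (λ _ {f} → σ-positive {f})

  all-⊤ : ∀ (w : Word) → All (λ _ → ⊤) w
  all-⊤ w = All.tabulate (λ _ → tt)

  Pos-∷-exclusive : ∀ w s → Strict.Pos w s → ¬ Strict.Pos (s ∷ w) s
  Pos-∷-exclusive w s p p′ = ℤ.<-asym (p base-fundamental)
    (subst (ℤ._< 0ℤ) (ℤ.neg-involutive _)
      (ℤ.neg-mono-< (subst (0ℤ ℤ.<_) (act-same s (actW w ρ) base) (p′ base-fundamental))))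

  HasLength-≈ : ∀ {u v k} → u ≈ v → HasLength u k → HasLength v k
  HasLength-≈ e ((w , w≈u , l) , min) = (w , ≈-trans w≈u e , l) , λ x x≈v → min x (≈-trans x≈v (≈-sym e))

  HasLength-reverse : ∀ {w k} → HasLength w k → HasLength (reverse w) k
  HasLength-reverse {w} ((u , u≈w , l) , min) =
    (reverse u , ≈-reverse u≈w , trans (List.length-reverse u) l) ,
    λ x x≈ → subst (_ ℕ.≤_) (List.length-reverse x)
      (min (reverse x) (≈-trans (≈-reverse x≈) (≡⇒≈ (List.reverse-involutive w))))

  -- A word for `s ∷ w` cannot be positive over `s`, so it drops `s`, and the shorter remainder
  -- represents `w`.
  HasLength-∷ : ∀ {w s k} → Strict.Pos w s → HasLength w k → HasLength (s ∷ w) (suc k)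
  HasLength-∷ {w} {s} {k} p ((u , u≈w , l) , min) = (s ∷ u , ≈-∷ s u≈w , cong suc l) , minimal
    where
    minimal : ∀ x → x ≈ s ∷ w → suc k ℕ.≤ length x
    minimal x x≈ with Strict.pos⊎drop (all-⊤ x) {s} tt
    ... | inj₁ p′ = ⊥-elim (Pos-∷-exclusive w s p (Strict.Pos-≈ x≈ p′))
    ... | inj₂ (x′ , x≈′ , _ , lt) = ℕ.≤-trans (s≤s (min x′
      (≈-trans (≈-flip (≈-sym x≈′)) (≈-trans (≈-∷ s x≈) (≈-cancel s w))))) lt

  -- Built letter by letter: a positive letter adds one to the length, and a drop replaces the whole
  -- word by a shorter one.
  hasLength : ∀ w → ∃[ k ] HasLength w k
  hasLength w = go (length w) w ℕ.≤-refl
    where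
    go : ∀ N w → length w ℕ.≤ N → ∃[ k ] HasLength w k
    go N       []      _        = 0 , ([] , ≈-refl , refl) , λ _ _ → z≤n
    go (suc N) (t ∷ w) (s≤s le) with Strict.pos⊎drop (all-⊤ w) {t} tt
    ... | inj₁ p = let k , h = go N w le in suc k , HasLength-∷ p h
    ... | inj₂ (w′ , w≈ , _ , lt) = let k , h = go N w′ (ℕ.≤-trans (ℕ.<⇒≤ lt) le) in
      k , HasLength-≈ (≈-trans (≈-sym (≈-cancel t w′)) (≈-∷ t (≈-sym w≈))) h

  pos⊎pos : ∀ w s → Strict.Pos w s ⊎ Strict.Pos (s ∷ w) s
  pos⊎pos w s = go (length w) w ℕ.≤-refl
    where
    go : ∀ N w → length w ℕ.≤ N → Strict.Pos w s ⊎ Strict.Pos (s ∷ w) s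
    go N w le with Strict.pos⊎drop (all-⊤ w) {s} tt
    ... | inj₁ p = inj₁ p
    go zero    w le | inj₂ (_ , _ , _ , lt) = ⊥-elim (ℕ.n≮0 (ℕ.<-≤-trans lt le))
    go (suc N) w le | inj₂ (w′ , w≈ , _ , lt) with go N w′ (ℕ.≤-pred (ℕ.<-≤-trans lt le))
    ... | inj₁ p = inj₂ (Strict.Pos-≈ (≈-flip (≈-sym w≈)) p)
    ... | inj₂ p = inj₁ (Strict.Pos-≈ (≈-sym w≈) p)

  LenDownʳ-pos : ∀ w s → Strict.Pos (reverse w) s → LenDownʳ (w ++ [ s ]) s
  LenDownʳ-pos w s p with hasLength (reverse w)
  ... | k , h = k ,
    HasLength-≈ (≈-trans (≡⇒≈ (List.reverse-involutive w)) (≈-sym (≈-snoc-cancel w s))) (HasLength-reverse h) ,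
    HasLength-≈ (≡⇒≈ (trans (List.unfold-reverse s (reverse w)) (cong (_++ [ s ]) (List.reverse-involutive w))))
      (HasLength-reverse (HasLength-∷ p h))

  LenDownʳ-≈ : ∀ {u v s} → u ≈ v → LenDownʳ u s → LenDownʳ v s
  LenDownʳ-≈ e (k , h , h′) = k , HasLength-≈ (≈-++ʳ _ e) h , HasLength-≈ e h′

  -- Reversal turns the left alternative into a right one, so that Tw2 always applies at one of the
  -- two codistances.
  LenDownʳ-dichotomy : ∀ w s → LenDownʳ w s ⊎ LenDownʳ (w ++ [ s ]) s
  LenDownʳ-dichotomy w s with pos⊎pos (reverse w) s
  ... | inj₁ p = inj₂ (LenDownʳ-pos w s p)
  ... | inj₂ p = inj₁ (LenDownʳ-≈ (≈-snoc-cancel w s)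
      (LenDownʳ-pos (w ++ [ s ]) s (Strict.Pos-≈ (≡⇒≈ (sym (List.reverse-++ w [ s ]))) p)))

  -- Maximal parabolic subgroups and centralisers of generators

  Avoids : Fin n → Word → Set
  Avoids s = All (_≢ s)

  ω-avoids : ∀ {s u} → Avoids s u → actW u (ω s) ≐ ω s
  ω-avoids {s} []                 r f = refl
  ω-avoids {s} {t ∷ u} (t≢s ∷ av) = ≐-trans (act-cong t (ω-avoids av)) (act-fix (ω-other t≢s))

  private
    σ₁ : ℤ
    σ₁ = σ base

    -σ₁≱0 : ¬ (0ℤ ℤ.≤ - σ₁)
    -σ₁≱0 le = ℤ.<⇒≱ (ℤ.neg-mono-< (σ-positive base-fundamental)) le

    act-ω : ∀ s → act s (ω s) s base ≡ - σ₁
    act-ω s = trans (act-same s (ω s) base) (cong -_ (ω-same s base))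

  -- A word avoiding s fixes the fundamental weight ω s, which s moves.
  s∉⟨S∖s⟩ : ∀ {s u u′} → Avoids s u → Avoids s u′ → ¬ (s ∷ u ≈ u′)
  s∉⟨S∖s⟩ {s} {u} {u′} av av′ e = -σ₁≱0 (ℤ.≤-trans (ℤ.<⇒≤ (σ-positive base-fundamental)) (ℤ.≤-reflexive (begin
    σ₁                        ≡⟨ ω-same s base ⟨
    ω s s base                ≡⟨ ω-avoids av′ s base ⟨
    actW u′ (ω s) s base      ≡⟨ actW-≈ e (ω-proper s) s base ⟨
    act s (actW u (ω s)) s base ≡⟨ act-cong s (ω-avoids av) s base ⟩
    act s (ω s) s base        ≡⟨ act-ω s ⟩
    - σ₁ ∎)))
    where open ≡-Reasoning

  generator-injective : ∀ {s t} → [ s ] ≈ [ t ] → s ≡ t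
  generator-injective {s} {t} e with t Fin.≟ s
  ... | yes refl = refl
  ... | no t≢s   = ⊥-elim (s∉⟨S∖s⟩ [] (t≢s ∷ []) e)

  nonneg-ω : ∀ s {r f} → Fundamental f → 0ℤ ℤ.≤ ω s r f
  nonneg-ω s {r} F with does (r Fin.≟ s)
  ... | true  = ℤ.<⇒≤ (σ-positive F)
  ... | false = ℤ.≤-refl

  -- A word `t ∷ w` in the intersection fixes `ω t`, so `w` takes `ω t` to its reflection, which is
  -- negative over `t`. Hence `w` drops `t`, and the word can be shortened.
  trivial-intersection : ∀ w → (∀ s → ∃[ u ] (u ≈ w × Avoids s u)) → w ≈ []
  trivial-intersection w = go (length w) w ℕ.≤-refl
    where
    go : ∀ N w → length w ℕ.≤ N → (∀ s → ∃[ u ] (u ≈ w × Avoids s u)) → w ≈ []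
    go N       []      _        av = ≈-refl
    go (suc N) (t ∷ w) (s≤s le) av with Weak.pos⊎drop (all-⊤ w) {t} tt
      where
      module Weak = Positivity (λ _ → ⊤) {λ x → 0ℤ ℤ.≤ x} ℤ.+-mono-≤ (ω-proper t) (λ {r} _ {f} → nonneg-ω t {r} {f})
    ... | inj₁ p = ⊥-elim (-σ₁≱0 (subst (0ℤ ℤ.≤_) eq (p base-fundamental)))
      where
      fixed : actW (t ∷ w) (ω t) ≐ ω t
      fixed = let _ , u≈ , a = av t in ≐-trans (actW-≈ (≈-sym u≈) (ω-proper t)) (ω-avoids a)
      eq : actW w (ω t) t base ≡ - σ₁
      eq = trans (sym (act-involutive t (actW w (ω t)) t base))
        (trans (act-cong t fixed t base) (act-ω t))
    ... | inj₂ (w′ , w≈ , _ , lt) = ≈-trans e (go N w′ (ℕ.≤-trans (ℕ.<⇒≤ lt) le)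
        (λ s → let u , u≈ , a = av s in u , ≈-trans u≈ e , a))
      where
      e : t ∷ w ≈ w′
      e = ≈-trans (≈-∷ t w≈) (≈-cancel t w′)

  private
    m₂ : ∀ s t → s ≢ t → Edge s t ⊎ m s t ≡ 2
    m₂ s t s≢t with m s t | offdia s t s≢t
    ... | 0                 | _            = inj₁ (s≢t , inj₁ refl)
    ... | 1                 | inj₂ (s≤s ())
    ... | 2                 | _            = inj₂ refl
    ... | suc (suc (suc _)) | _            = inj₁ (s≢t , inj₂ (s≤s (s≤s (s≤s z≤n))))

    commute : ∀ {s t} → m s t ≡ 2 → ∀ w → s ∷ t ∷ w ≈ t ∷ s ∷ w
    commute {s} {t} eq w = subst (λ k → alt s t k ++ w ≈ alt t s k ++ w) eq
      (≈-step [] w (braid s t (subst (1 ℕ.≤_) (sym eq) (s≤s z≤n))))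

  module _ (s : Fin n) where

    private
      ν : State
      ν = act s (ω s)

      ν-proper : Proper ν
      ν-proper = act-proper s (ω-proper s)

      ν-other : ∀ {r} → r ≢ s → ∀ f → let c = coord s r in
                ν r f ≡ σ (f [ c ]≔ (lookup f c + 1ℤ)) + σ (f [ c ]≔ (lookup f c - 1ℤ))
      ν-other {r} r≢s f = trans (act-other r≢s (ω s) f)
        (cong₂ _+_ (trans (cong₂ _+_ (ω-other r≢s f) (ω-same s f₊)) (ℤ.+-identityˡ (σ f₊))) (ω-same s f₋))
        where
        c = coord s r
        f₊ = f [ c ]≔ (lookup f c + 1ℤ)
        f₋ = f [ c ]≔ (lookup f c - 1ℤ)

      ν-nonneg : ∀ {r} → r ≢ s → ∀ {f} → Fundamental f → 0ℤ ℤ.≤ ν r f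
      ν-nonneg {r} r≢s {f} F = subst (0ℤ ℤ.≤_) (sym (ν-other r≢s f))
        (let p , q = σ-line-nonneg F (coord s r) in ℤ.+-mono-≤ p q)

      ν-edge : ∀ {t} → Edge s t → 0ℤ ℤ.< ν t base
      ν-edge {t} (s≢t , h) = subst (0ℤ ℤ.<_) (sym (ν-other (s≢t ∘ sym) base))
        (ℤ.+-mono-<-≤ (σ-positive (fundamental-line base-fundamental c int))
          (proj₂ (σ-line-nonneg base-fundamental c)))
        where
        c = coord s t
        int : Interior (bd c) (lookup base c + 1ℤ)
        -- On an edge m is infinite or at least 3, so the point 2 next to the base value 1 is still
        -- interior.
        int rewrite lookup-replicate c 1ℤ = 1 , refl , subst (λ b → b ≡ 0 ⊎ 2 ℕ.< b) (sym (bd-coord s≢t)) h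

      module Rel-ν = Positivity (_≢ s) {λ x → 0ℤ ℤ.≤ x} ℤ.+-mono-≤ ν-proper ν-nonneg

    -- u fixes ν = s ω_s, which is dominant for ⟨S∖s⟩; stabilisers of dominant weights are
    -- generated by the simple reflections they contain, and those commute with s.
    centralising : ∀ u u′ → Avoids s u → Avoids s u′ → u ++ [ s ] ≈ s ∷ u′ →
                   ∃[ v ] (v ≈ u × All (λ t → ¬ Edge s t) v)
    centralising u u′ av av′ e = go (length u) u u′ ℕ.≤-refl av av′ e
      where
      go : ∀ N u u′ → length u ℕ.≤ N → Avoids s u → Avoids s u′ → u ++ [ s ] ≈ s ∷ u′ →
           ∃[ v ] (v ≈ u × All (λ t → ¬ Edge s t) v)
      go N       []      u′ _        _           _   _ = [] , ≈-refl , []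
      go (suc N) (t ∷ u) u′ (s≤s le) (t≢s ∷ av) av′ e with m₂ s t (t≢s ∘ sym)
      -- A letter commuting with `s` is kept, and moved past `s` into the right-hand word.
      ... | inj₂ m≡2 = t ∷ proj₁ IH , ≈-∷ t (proj₁ (proj₂ IH)) ,
            ¬edge ∷ proj₂ (proj₂ IH)
        where
        ¬edge : ¬ Edge s t
        ¬edge (_ , inj₁ m≡0) = contradiction (trans (sym m≡2) m≡0) λ ()
        ¬edge (_ , inj₂ 3≤m) = ℕ.<-irrefl (sym m≡2) 3≤m
        IH = go N u (t ∷ u′) le av (t≢s ∷ av′) (≈-trans (≈-flip e) (≈-sym (commute m≡2 u′)))
      ... | inj₁ edge with Rel-ν.pos⊎drop av t≢s
      -- Since `t ∷ u` fixes `ν`, the word `u` takes `ν` to its reflection in `t`, which is negative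
      -- over the neighbour `t` of `s`.
      ...   | inj₁ p = ⊥-elim (ℤ.<⇒≱ (ℤ.neg-mono-< (ν-edge edge)) (subst (0ℤ ℤ.≤_) eq (p base-fundamental)))
        where
        fixed : actW (t ∷ u) ν ≐ ν
        fixed = ≐-trans (λ r f → cong (λ μ → μ r f) (sym (actW-++ (t ∷ u) [ s ] (ω s))))
          (≐-trans (actW-≈ e (ω-proper s)) (act-cong s (ω-avoids av′)))
        eq : actW u ν t base ≡ - ν t base
        eq = trans (sym (act-involutive t (actW u ν) t base)) (trans (act-cong t fixed t base) (act-same t ν base))
      ...   | inj₂ (w , u≈ , avw , lt) =
            let v , v≈ , a = go N w u′ (ℕ.≤-trans (ℕ.<⇒≤ lt) le) avw av′ (≈-trans (≈-++ʳ [ s ] (≈-sym tu≈w)) e)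
            in v , ≈-trans v≈ (≈-sym tu≈w) , a
        where
        tu≈w : t ∷ u ≈ w
        tu≈w = ≈-trans (≈-∷ t u≈) (≈-cancel t w)

  -- Otherwise `u ++ [ p ]` avoids `s` as well, which places `s` in the subgroup generated by the
  -- others. This recovers the type of an image panel from codistances.
  conjugate-avoids : ∀ {s p u u′} → Avoids s u → Avoids s u′ → s ∷ u ++ [ p ] ≈ u′ → p ≡ s
  conjugate-avoids {s} {p} av av′ e with p Fin.≟ s
  ... | yes p≡s = p≡s
  ... | no p≢s  = ⊥-elim (s∉⟨S∖s⟩ (All.++⁺ av (p≢s ∷ [])) av′ e)

-- Panels, galleries and codistances

module TwinProperties {ℓ : Level} {n : ℕ} {M : CoxeterMatrix n} (Δ : TwinBuilding M ℓ) where
  open Coxeter M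
  open CoxeterGroup M
  open TwinBuilding Δ
  open TwinNotions Δ

  private
    module Half (e : Bool) where
      open IsBuilding (bldg e)

      adj-sym : ∀ {s x y} → δ e x y ≈ [ s ] → δ e y x ≈ [ s ]
      adj-sym {s} {x} {y} xy with proj₁ (WD2 y x x s xy)
      ... | inj₁ h = ≈-flip (≈-trans (≈-sym h) (WD1' x))
      ... | inj₂ h with WD1 y x (≈-trans (≈-sym h) (WD1' x))
      ...   | refl = xy

      panel : ∀ {s x y z} → δ e x y ≈ [ s ] → δ e x z ≈ [ s ] → y ≡ z ⊎ δ e y z ≈ [ s ]
      panel {s} {x} {y} {z} xy xz with proj₁ (WD2 x z y s (adj-sym xy))
      ... | inj₁ h = inj₁ (WD1 y z (≈-trans h (≈-trans (≈-∷ s xz) (≈-cancel s []))))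
      ... | inj₂ h = inj₂ (≈-trans h xz)

      -- By WD2 the third side of a triangle has the distance `s t` or `t`; parity excludes the
      -- product, and symmetry gives the rest. Types in a panel can thus be compared through
      -- adjacency alone, which is all that an automorphism preserves.
      triangle : ∀ {s t r x y z} → δ e x y ≈ [ s ] → δ e x z ≈ [ t ] → δ e y z ≈ [ r ] → s ≡ t
      triangle {s} {t} {r} {x} {y} {z} xy xz yz = trans (edge xz xy (adj-sym yz)) (sym (edge xy xz yz))
        where
        edge : ∀ {s t x y z} → δ e x y ≈ [ s ] → δ e x z ≈ [ t ] → δ e y z ≈ [ r ] → t ≡ r
        edge {s} {t} {x} {y} {z} xy xz yz with proj₁ (WD2 x z y s (adj-sym xy))
        ... | inj₁ h = contradiction (parity-≈ (≈-trans (≈-sym yz) (≈-trans h (≈-∷ s xz)))) λ ()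
        ... | inj₂ h = generator-injective (≈-trans (≈-sym xz) (≈-trans (≈-sym h) yz))

      neighbour : ∀ s x → ∃[ y ] δ e x y ≈ [ s ]
      neighbour s x = let y , yx , _ = WD3 x x s in y , adj-sym yx

      gallery : ∀ {P : Fin n → Set} u {x z} → δ e x z ≈ u → All P u →
                Star (λ x y → ∃[ t ] (P t × δ e x y ≈ [ t ])) x z
      gallery []      {x} {z} xz [] with WD1 x z xz
      ... | refl = ε
      gallery (t ∷ u) {x} {z} xz (Pt ∷ Pu) = let y , yx , yz = WD3 x z t in
        (t , Pt , adj-sym yx) ◅ gallery u (≈-trans yz (≈-trans (≈-∷ t xz) (≈-cancel t u))) Pu

  AdjS-sym : ∀ {s} x y → AdjS s x y → AdjS s y x
  AdjS-sym (true  , x) (true  , y) = Half.adj-sym true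
  AdjS-sym (false , x) (false , y) = Half.adj-sym false

  AdjS-panel : ∀ {s} x y z → AdjS s x y → AdjS s x z → y ≡ z ⊎ AdjS s y z
  AdjS-panel (true  , x) (true  , y) (true  , z) xy xz = Sum.map₁ (cong (true ,_)) (Half.panel true xy xz)
  AdjS-panel (false , x) (false , y) (false , z) xy xz = Sum.map₁ (cong (false ,_)) (Half.panel false xy xz)

  AdjS-unique : ∀ {s t} x y → AdjS s x y → AdjS t x y → s ≡ t
  AdjS-unique (true  , x) (true  , y) p q = generator-injective (≈-trans (≈-sym p) q)
  AdjS-unique (false , x) (false , y) p q = generator-injective (≈-trans (≈-sym p) q)

  AdjS-triangle : ∀ {s t} x y z → AdjS s x y → AdjS t x z → y ≡ z ⊎ Adj y z → s ≡ t
  AdjS-triangle x y z xy xz (inj₁ refl) = AdjS-unique x y xy xz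
  AdjS-triangle (true  , x) (true  , y) (true  , z) xy xz (inj₂ (_ , yz)) = Half.triangle true xy xz yz
  AdjS-triangle (false , x) (false , y) (false , z) xy xz (inj₂ (_ , yz)) = Half.triangle false xy xz yz

  AdjS-exists : ∀ s x → ∃[ y ] AdjS s x y
  AdjS-exists s (true  , x) = let y , xy = Half.neighbour true s x in (true , y) , xy
  AdjS-exists s (false , x) = let y , xy = Half.neighbour false s x in (false , y) , xy

  -- Codistance as a relation, so that it makes sense for chambers whose halves are not known in
  -- advance.
  Cod : Chamber → Chamber → Word → Set
  Cod (true  , x) (false , y) w = δ* true x y ≈ w
  Cod (false , x) (true  , y) w = δ* false x y ≈ w
  Cod (true  , x) (true  , y) w = ⊥
  Cod (false , x) (false , y) w = ⊥

  Opp⇒Cod : ∀ x y → Opp x y → Cod x y []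
  Opp⇒Cod (true  , x) (false , y) h = h
  Opp⇒Cod (false , x) (true  , y) h = h

  Cod⇒Opp : ∀ x y → Cod x y [] → Opp x y
  Cod⇒Opp (true  , x) (false , y) h = h
  Cod⇒Opp (false , x) (true  , y) h = h

  Cod-≈ : ∀ x y {u v} → Cod x y u → u ≈ v → Cod x y v
  Cod-≈ (true  , x) (false , y) = ≈-trans
  Cod-≈ (false , x) (true  , y) = ≈-trans

  Cod-unique : ∀ x y {u v} → Cod x y u → Cod x y v → u ≈ v
  Cod-unique (true  , x) (false , y) h h′ = ≈-trans (≈-sym h) h′
  Cod-unique (false , x) (true  , y) h h′ = ≈-trans (≈-sym h) h′

  Cod-sym : ∀ x y {w} → Cod x y w → Cod y x (reverse w)
  Cod-sym (true  , x) (false , y) h = ≈-trans (Tw1⁺ x y) (≈-reverse h)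
  Cod-sym (false , x) (true  , y) h = ≈-trans (Tw1⁻ x y) (≈-reverse h)

  private
    -- If `s` shortens `w`, Tw2 settles the matter. Otherwise Tw3 gives one chamber of the panel at
    -- codistance `w s`, and Tw2 brings every other chamber of the panel back to `w`.
    move-half : ∀ e {s w} x y y′ → δ* e x y ≈ w → δ (not e) y y′ ≈ [ s ] → δ* e x y′ ≈ w ⊎ δ* e x y′ ≈ w ++ [ s ]
    move-half e {s} {w} x y y′ xy yy′ with LenDownʳ-dichotomy w s
    ... | inj₁ down = inj₂ (≈-trans (Tw2 e x y y′ s yy′ (LenDownʳ-≈ (≈-sym xy) down)) (≈-++ʳ [ s ] xy))
    ... | inj₂ down with Tw3 e x y s
    ...   | y″ , yy″ , xy″ with Half.panel (not e) yy″ yy′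
    ...     | inj₁ refl = inj₂ (≈-trans xy″ (≈-++ʳ [ s ] xy))
    ...     | inj₂ y″y′ = inj₁ (≈-trans
              (Tw2 e x y″ y′ s y″y′ (LenDownʳ-≈ (≈-sym xy″w) down))
              (≈-trans (≈-++ʳ [ s ] xy″w) (≈-snoc-cancel w s)))
      where xy″w = ≈-trans xy″ (≈-++ʳ [ s ] xy)

  Cod-moveʳ : ∀ {s w} x y y′ → Cod x y w → AdjS s y y′ → Cod x y′ w ⊎ Cod x y′ (w ++ [ s ])
  Cod-moveʳ (true  , x) (false , y) (false , y′) = move-half true x y y′
  Cod-moveʳ (false , x) (true  , y) (true  , y′) = move-half false x y y′

  Cod-existsʳ : ∀ s {w} x y → Cod x y w → ∃[ y′ ] (AdjS s y y′ × Cod x y′ (w ++ [ s ]))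
  Cod-existsʳ s (true  , x) (false , y) h =
    let y′ , a , c = Tw3 true x y s in (false , y′) , a , ≈-trans c (≈-++ʳ [ s ] h)
  Cod-existsʳ s (false , x) (true  , y) h =
    let y′ , a , c = Tw3 false x y s in (true , y′) , a , ≈-trans c (≈-++ʳ [ s ] h)

  private
    reverse-snoc : ∀ (s : Fin n) (w : Word) → reverse (reverse w ++ [ s ]) ≡ s ∷ w
    reverse-snoc s w = trans (List.reverse-++ (reverse w) [ s ]) (cong (s ∷_) (List.reverse-involutive w))

  Cod-moveˡ : ∀ {s w} x x′ y → Cod x y w → AdjS s x x′ → Cod x′ y w ⊎ Cod x′ y (s ∷ w)
  Cod-moveˡ {s} {w} x x′ y h a = Sum.map
    (λ c → subst (Cod x′ y) (List.reverse-involutive w) (Cod-sym y x′ c))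
    (λ c → subst (Cod x′ y) (reverse-snoc s w) (Cod-sym y x′ c))
    (Cod-moveʳ y x x′ (Cod-sym x y h) a)

  Cod-existsˡ : ∀ s {w} x y → Cod x y w → ∃[ x′ ] (AdjS s x x′ × Cod x′ y (s ∷ w))
  Cod-existsˡ s {w} x y h = let x′ , a , c = Cod-existsʳ s y x (Cod-sym x y h) in
    x′ , a , subst (Cod x′ y) (reverse-snoc s w) (Cod-sym y x′ c)

  StepAvoiding : Fin n → Chamber → Chamber → Set
  StepAvoiding s x y = ∃[ t ] (t ≢ s × AdjS t x y)

  GalleryAvoiding : Fin n → Chamber → Chamber → Set ℓ
  GalleryAvoiding s = Star (StepAvoiding s)

  gallery-sym : ∀ {s x y} → GalleryAvoiding s x y → GalleryAvoiding s y x
  gallery-sym = Star.reverse (λ {x} {y} (t , t≢s , a) → t , t≢s , AdjS-sym x y a)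

  InRes⇒gallery : ∀ {s J} → s ∈ J → ∀ x y → InRes (∁ J) x y → GalleryAvoiding s x y
  InRes⇒gallery {s} {J} s∈J x y = go x y
    where
    avoids : ∀ {u} → All (_∈ ∁ J) u → Avoids s u
    avoids = All.map (λ t∈ → λ { refl → x∈∁p⇒x∉p t∈ s∈J })
    go : ∀ x y → InRes (∁ J) x y → GalleryAvoiding s x y
    go (true  , x) (true  , y) (u , u≈ , a) = Star.gmap (true ,_) id (Half.gallery true u (≈-sym u≈) (avoids a))
    go (false , x) (false , y) (u , u≈ , a) = Star.gmap (false ,_) id (Half.gallery false u (≈-sym u≈) (avoids a))

  InRes-refl : ∀ J x → InRes J x x
  InRes-refl J (true  , x) = [] , ≈-sym (IsBuilding.WD1' (bldg true) x) , []
  InRes-refl J (false , x) = [] , ≈-sym (IsBuilding.WD1' (bldg false) x) , []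

  Cod-galleryʳ : ∀ {s w} x {y z} → Cod x y w → GalleryAvoiding s y z → ∃[ u ] (Avoids s u × Cod x z (w ++ u))
  Cod-galleryʳ {w = w} x {y} h ε = [] , [] , subst (Cod x y) (sym (List.++-identityʳ w)) h
  Cod-galleryʳ {w = w} x {y} {z} h (_◅_ {j = y′} (t , t≢s , a) g) with Cod-moveʳ x y y′ h a
  ... | inj₁ h′ = Cod-galleryʳ x h′ g
  ... | inj₂ h′ = let u , av , c = Cod-galleryʳ x h′ g in
    t ∷ u , t≢s ∷ av , subst (Cod x z) (List.++-assoc w [ t ] u) c

  Cod-galleryˡ : ∀ {s w x y} z → Avoids s w → Cod x z w → GalleryAvoiding s x y → ∃[ u ] (Avoids s u × Cod y z u)
  Cod-galleryˡ z av h ε = _ , av , h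
  Cod-galleryˡ {x = x} z av h (_◅_ {j = x′} (t , t≢s , a) g) with Cod-moveˡ x x′ z h a
  ... | inj₁ h′ = Cod-galleryˡ z av h′ g
  ... | inj₂ h′ = Cod-galleryˡ z (t≢s ∷ av) h′ g

  -- Each step of the gallery cancels the first letter of the codistance.
  opposite-avoiding : ∀ {s} w x z → Avoids s w → Cod x z w → ∃[ y ] (GalleryAvoiding s x y × Opp y z)
  opposite-avoiding []      x z _          h = x , ε , Cod⇒Opp x z h
  opposite-avoiding (t ∷ w) x z (t≢s ∷ av) h =
    let x′ , a , c = Cod-existsˡ t x z h
        y , g , o  = opposite-avoiding w x′ z av (Cod-≈ x′ z c (≈-cancel t w))
    in y , (t , t≢s , a) ◅ g , o

  -- Displacements of an automorphism

  module _ (A : Automorphism) where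
    open Automorphism A

    private
      θ-inj : ∀ {x y} → θ x ≡ θ y → x ≡ y
      θ-inj = proj₁ bij

      θ-surj : ∀ y → ∃[ x ] θ x ≡ y
      θ-surj y = let x , h = proj₂ bij y in x , h refl

      θ-adj : ∀ {s} x y → AdjS s x y → Adj (θ x) (θ y)
      θ-adj x y a = Equivalence.to (adj x y) (_ , a)

      θ⁻¹-panel : ∀ x y → θ x ≡ θ y ⊎ Adj (θ x) (θ y) → x ≡ y ⊎ Adj x y
      θ⁻¹-panel x y = Sum.map θ-inj (Equivalence.from (adj x y))

      θ-panel : ∀ x y → x ≡ y ⊎ Adj x y → θ x ≡ θ y ⊎ Adj (θ x) (θ y)
      θ-panel x y = Sum.map (cong θ) (Equivalence.to (adj x y))

      forget : ∀ {s} {x y : Chamber} → x ≡ y ⊎ AdjS s x y → x ≡ y ⊎ Adj x y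
      forget = Sum.map₂ (_ ,_)

    Displacement∌ : Fin n → Set ℓ
    Displacement∌ s = ∀ x → ∃[ u ] (Avoids s u × Cod x (θ x) u)

    module _ {s : Fin n} (H : ∀ (y : Chamber) → ∃[ z ] (GalleryAvoiding s y z × Opp y (θ z))) where

      -- Suppose θ takes the s-panel of z to a p-panel with p ≢ s. Some y′ p-adjacent to y has codistance p
      -- from θ z, and is opposite θ z′ for a z′ in the residue of z. Then θ⁻¹ y′ has codistance s from z
      -- but is opposite z′, contradicting s ∉ ⟨S∖s⟩.
      preserves-s-panel : ∀ y z → GalleryAvoiding s y z → Opp y (θ z) →
                          ∃[ x ] (AdjS s z x × AdjS s (θ z) (θ x))
      preserves-s-panel y z g o with AdjS-exists s z
      ... | x , zx with θ-adj z x zx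
      ...   | p , θzx with p Fin.≟ s
      ...     | yes refl = x , zx , θzx
      ...     | no p≢s with Cod-existsˡ p y (θ z) (Opp⇒Cod y (θ z) o)
      -- `D` is a chamber of the `p`-panel of `θ z` opposite `y′`. Both `y′` and `D` are then pulled
      -- back along `θ`.
      ...       | y′ , yy′ , y′θz with H y′ | Cod-existsʳ p y′ (θ z) y′θz
      ...         | z′ , g′ , o′ | D , θzD , y′D with θ-surj y′ | θ-surj D
      ...           | q , refl | x′ , refl = ⊥-elim contra
        where
        ¬oppqz : ¬ Opp q z
        ¬oppqz oqz = s∉⟨S∖s⟩ [] [] (Cod-unique (θ q) (θ z) y′θz (Opp⇒Cod (θ q) (θ z) (Equivalence.to (opp q z) oqz)))
        oppqx′ : Opp q x′
        oppqx′ = Equivalence.from (opp q x′) (Cod⇒Opp (θ q) (θ x′) (Cod-≈ (θ q) (θ x′) y′D (≈-cancel p [])))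
        -- `θ x` and `θ x′` share a panel with `θ z`, so `x` and `x′` are equal or adjacent, and the
        -- type of `x` passes to `x′`.
        zx′ : AdjS s z x′
        zx′ with Equivalence.from (adj z x′) (p , θzD)
        ... | r , a with AdjS-triangle z x x′ zx a (θ⁻¹-panel x x′ (forget (AdjS-panel (θ z) (θ x) (θ x′) θzx θzD)))
        ...   | refl = a
        -- `q` is opposite `x′` but not `z`, so the step from `x′` to `z` has to change the
        -- codistance.
        qz : Cod q z [ s ]
        qz with Cod-moveʳ q x′ z (Opp⇒Cod q x′ oppqx′) (AdjS-sym z x′ zx′)
        ... | inj₁ c = ⊥-elim (¬oppqz (Cod⇒Opp q z c))
        ... | inj₂ c = c
        zz′ : GalleryAvoiding s z z′
        zz′ = gallery-sym g ◅◅ (p , p≢s , yy′) ◅ g′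
        contra : ⊥
        contra with Cod-galleryʳ q qz zz′
        ... | u , av , c = s∉⟨S∖s⟩ av [] (Cod-unique q z′ c (Opp⇒Cod q z′ (Equivalence.from (opp q z′) o′)))

      private
        Good : Chamber → Set
        Good z = ∃[ u ] (Avoids s u × Cod z (θ z) u)

        -- A displacement avoiding `s` yields a chamber opposite `θ z` by a gallery avoiding `s`, so
        -- `preserves-s-panel` applies at `z`. The image of a step of type other than `s` therefore
        -- has type other than `s`.
        good-step : ∀ z z₁ → StepAvoiding s z z₁ → Good z → Good z₁
        good-step z z₁ (t , t≢s , a) (u , av , c) with opposite-avoiding u z (θ z) av c | θ-adj z z₁ a
        ... | y , g , o | r , b with preserves-s-panel y z (gallery-sym g) o
        ...   | x , zx , θzx = left (right (Cod-moveʳ z (θ z) (θ z₁) c b))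
          where
          r≢s : r ≢ s
          r≢s refl = t≢s (AdjS-triangle z z₁ x a zx (θ⁻¹-panel z₁ x (forget (AdjS-panel (θ z) (θ z₁) (θ x) b θzx))))
          right : Cod z (θ z₁) u ⊎ Cod z (θ z₁) (u ++ [ r ]) → ∃[ v ] (Avoids s v × Cod z (θ z₁) v)
          right (inj₁ h) = u , av , h
          right (inj₂ h) = u ++ [ r ] , All.++⁺ av (r≢s ∷ []) , h
          left : ∃[ v ] (Avoids s v × Cod z (θ z₁) v) → Good z₁
          left (v , av′ , h) = Cod-galleryˡ (θ z₁) av′ h ((t , t≢s , a) ◅ ε)

        good-gallery : ∀ {z z₁} → GalleryAvoiding s z z₁ → Good z → Good z₁
        good-gallery ε       h = h
        good-gallery (a ◅ g) h = good-gallery g (good-step _ _ a h)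

      displacement-base : Displacement∌ s
      -- Opposition of `z` and `θ z₀` makes `z₀` good, and goodness travels back along the gallery.
      displacement-base z = let z₀ , g , o = H z in
        good-gallery (gallery-sym g) (Cod-galleryˡ (θ z₀) [] (Opp⇒Cod z (θ z₀) o) g)

    -- With `z′` at codistance `s u` from `θ z`, the codistance of `z′` and `θ z′` is `s u` or
    -- `s u p`. Only the second can avoid `s`, and it forces p = s; then `centralising` rewrites `u`
    -- without neighbours of `s`.
    displacement-edge : ∀ {s t} → Edge s t → Displacement∌ s → Displacement∌ t
    displacement-edge {s} {t} edge D z with D z
    ... | u , av , c with Cod-existsˡ s z (θ z) c
    ...   | z′ , a , c′ with D z′ | θ-adj z z′ a
    ...     | u′ , av′ , c″ | p , b with Cod-moveʳ z′ (θ z) (θ z′) c′ b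
    ...       | inj₁ h = ⊥-elim (s∉⟨S∖s⟩ av av′ (Cod-unique z′ (θ z′) h c″))
    ...       | inj₂ h with conjugate-avoids av av′ (Cod-unique z′ (θ z′) h c″)
    ...         | refl with centralising s u u′ av av′ (≈-flip (Cod-unique z′ (θ z′) h c″))
    ...           | v , v≈u , nonadjacent =
      v , All.map (λ ¬e → λ { refl → ¬e edge }) nonadjacent , Cod-≈ z (θ z) c (≈-sym v≈u)

    displacement-all : ∀ {s t} → Star Edge s t → Displacement∌ s → Displacement∌ t
    displacement-all ε       D = D
    displacement-all (e ◅ p) D = displacement-all p (displacement-edge e D)

    -- The generator given as an argument provides a first word for the codistance of `x` and `θ x`.
    trivial-displacement : (∀ s → Displacement∌ s) → Fin n → MapsChambersOpp A
    trivial-displacement D s x with D s x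
    ... | w , _ , c = Cod⇒Opp x (θ x) (Cod-≈ x (θ x) c (trivial-intersection w
      (λ t → let u , av , c′ = D t x in u , Cod-unique x (θ x) c′ c , av)))

    residues⇒chambers : Irreducible M → ∀ J → Nonempty J → MapsResiduesOpp A (∁ J) → MapsChambersOpp A
    residues⇒chambers irr J (s , s∈J) R = trivial-displacement
      (λ t → displacement-all (irr s t) (displacement-base H)) s
      where
      H : ∀ y → ∃[ z ] (GalleryAvoiding s y z × Opp y (θ z))
      H y = let z , r , o = R y y (InRes-refl (∁ J) y) in z , InRes⇒gallery s∈J y z r , o

    chambers⇒residues : MapsChambersOpp A → ∀ K → MapsResiduesOpp A K
    chambers⇒residues C K x y r = y , r , C y

    -- The chamber `y₀` has codistance `s` from `θ x` and is opposite `θ y₀`, so the step from `θ x`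
    -- to `θ y₀` has type `s`. As `y` lies in the panel of `x` and `y₀`, this type carries over to
    -- `θ y`.
    type-preserving : MapsChambersOpp A → TypePreserving A
    type-preserving C s x y a with Cod-existsˡ s x (θ x) (Opp⇒Cod x (θ x) (C x))
    ... | y₀ , a₀ , c₀ with θ-adj x y₀ a₀ | θ-adj x y a
    ...   | p₀ , b₀ | p , b with Cod-moveʳ y₀ (θ x) (θ y₀) c₀ b₀
    ...     | inj₁ h = ⊥-elim (s∉⟨S∖s⟩ [] [] (Cod-unique y₀ (θ y₀) h (Opp⇒Cod y₀ (θ y₀) (C y₀))))
    ...     | inj₂ h with conjugate-avoids [] [] (Cod-unique y₀ (θ y₀) h (Opp⇒Cod y₀ (θ y₀) (C y₀)))
    ...       | refl with AdjS-triangle (θ x) (θ y₀) (θ y) b₀ b (θ-panel y₀ y (forget (AdjS-panel x y₀ y a₀ a)))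
    ...         | refl = b

theorem1p3 : ∀ {ℓ : Level} {n : ℕ} (M : CoxeterMatrix n) → Irreducible M →
    (Δ : TwinBuilding M ℓ) (J : Subset n) → Nonempty J →
    (A : TwinNotions.Automorphism Δ) →
    (TwinNotions.MapsResiduesOpp Δ A (∁ J) ⇔ TwinNotions.MapsChambersOpp Δ A)
    × (TwinNotions.MapsChambersOpp Δ A →
    TwinNotions.TypePreserving Δ A
    × (∀ (K : Subset n) → TwinNotions.MapsResiduesOpp Δ A K))
theorem1p3 M irr Δ J J≠∅ A =
  mk⇔ (residues⇒chambers A irr J J≠∅) (λ C → chambers⇒residues A C (∁ J)) ,
  λ C → type-preserving A C , chambers⇒residues A C
  where open TwinProperties Δ
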